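{- There is a computable copy $\mathcal{L}$ of $\omega$ such that for every $\Delta_2$ cohesive set $C$, $\prod_C \mathcal{L} \cong \omega + \eta$.
   Context: $\Delta_2$ refers to the arithmetical hierarchy of subsets of $\mathbb{N}$; c.e. means computably enumerable. For $X, Y \subseteq \mathbb{N}$, $X \subseteq^* Y$ means that $X \setminus Y$ is finite. A set $C \subseteq \mathbb{N}$ is cohesive if it is infinite and for every c.e. set $W$, either $C \subseteq^* W$ or $C \subseteq^* \mathbb{N} \setminus W$. A computable linear order $\mathcal{L} = (L; \prec_{\mathcal{L}})$ consists of a non-empty computable set $L \subseteq \mathbb{N}$ and a computable (strict) linear order relation $\prec_{\mathcal{L}}$ on $L$. A computable copy of $\omega$ is a computable linear order that is isomorphic to $(\mathbb{N}; <)$ (by a not necessarily computable isomorphism). $\omega$ and $\eta$ denote the order-types of $(\mathbb{N};<)$ and $(\mathbb{Q};<)$, and $+$ is the usual sum of linear orders. Cohesive power: for a computable linear order $\mathcal{L} = (L; \prec_{\mathcal{L}})$ and a cohesive set $C$, let $D$ be the set of partial computable functions $\varphi \colon \mathbb{N} \rightharpoonup L$ with $C \subseteq^* \mathrm{dom}(\varphi)$. For $\varphi, \psi \in D$, let $\varphi =_C \psi$ if $C \subseteq^* \{n : \varphi(n)\downarrow = \psi(n)\downarrow\}$; this is an equivalence relation, and $[\varphi]$ denotes the class of $\varphi$. The cohesive power $\prod_C \mathcal{L}$ is the linear order with domain $\{[\varphi] : \varphi \in D\}$ where $[\psi] \prec [\varphi]$ if and only if $C \subseteq^* \{n : \psi(n)\downarrow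 \prec_{\mathcal{L}} \varphi(n)\downarrow\}$. -}

module Defs where

open import Data.Fin.Base using (Fin; zero; suc)
open import Data.List.Base using (List)
import Data.List.Membership.Propositional as List
open import Data.Nat.Base using (ℕ; zero; suc; _<_)
import Data.Nat.Properties as ℕ
open import Data.Product.Base using (Σ; ∃; _×_; proj₁)
import Data.Rational.Properties as ℚ
open import Data.Sum.Base using (_⊎_)
open import Data.Sum.Relation.Binary.LeftOrder using (⊎-<-strictTotalOrder)
open import Data.Vec.Base using (Vec; []; _∷_; lookup)
open import Function.Base using (_on_)
open import Function.Bundles using (_⇔_)
open import Level using (0ℓ; _⊔_)
open import Relation.Binary.Bundles using (StrictTotalOrder)
open import Relation.Binary.Bundles.Raw using (RawRelation)
open import Relation.Binary.Core using (Rel)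
open import Relation.Binary.Morphism.Structures using (IsOrderIsomorphism)
open import Relation.Binary.PropositionalEquality.Core using (_≡_)
open import Relation.Binary.Structures using (IsStrictTotalOrder)
open import Relation.Nullary.Negation.Core using (¬_)
open import Relation.Unary using (Pred; _∈_; _≐_; _∖_; ∁)

-- Partial computable functions are Kleene's μ-recursive functions:
-- μRec k is the type of programs for k-ary ones, and f [ xs ]⇓ y says
-- that the partial function computed by f is defined at xs with value y.

data μRec : ℕ → Set where
  zero : μRec 0
  suc  : μRec 1
  proj : ∀ {k} → Fin k → μRec k
  comp : ∀ {k m} → μRec m → Vec (μRec k) m → μRec k
  prec : ∀ {k} → μRec k → μRec (suc (suc k)) → μRec (suc k)
  μ    : ∀ {k} → μRec (suc k) → μRec k

infix 4 _[_]⇓_ _[_]⇓*_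

mutual

  data _[_]⇓_ : ∀ {k} → μRec k → Vec ℕ k → ℕ → Set where
    zero  : zero [ [] ]⇓ 0
    suc   : ∀ {x} → suc [ x ∷ [] ]⇓ suc x
    proj  : ∀ {k} {xs : Vec ℕ k} (i : Fin k) → proj i [ xs ]⇓ lookup xs i
    comp  : ∀ {k m} {f : μRec m} {gs : Vec (μRec k) m} {xs ys z} →
            gs [ xs ]⇓* ys → f [ ys ]⇓ z → comp f gs [ xs ]⇓ z
    prec₀ : ∀ {k} {f : μRec k} {g xs y} →
            f [ xs ]⇓ y → prec f g [ 0 ∷ xs ]⇓ y
    precₛ : ∀ {k} {f : μRec k} {g n xs r y} →
            prec f g [ n ∷ xs ]⇓ r → g [ n ∷ r ∷ xs ]⇓ y →
            prec f g [ suc n ∷ xs ]⇓ y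
    μ     : ∀ {k} {f : μRec (suc k)} {n xs} →
            (∀ m → m < n → ∃ λ y → f [ m ∷ xs ]⇓ suc y) →
            f [ n ∷ xs ]⇓ 0 → μ f [ xs ]⇓ n

  data _[_]⇓*_ {k} : ∀ {m} → Vec (μRec k) m → Vec ℕ k → Vec ℕ m → Set where
    []  : ∀ {xs} → [] [ xs ]⇓* []
    _∷_ : ∀ {m} {g : μRec k} {gs : Vec (μRec k) m} {xs y ys} →
          g [ xs ]⇓ y → gs [ xs ]⇓* ys → (g ∷ gs) [ xs ]⇓* (y ∷ ys)

infix 4 _⟨_⟩↓=_

_⟨_⟩↓=_ : μRec 1 → ℕ → ℕ → Set
φ ⟨ n ⟩↓= m = φ [ n ∷ [] ]⇓ m

dom : μRec 1 → Pred ℕ 0ℓ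
dom φ n = ∃ λ m → φ ⟨ n ⟩↓= m

-- The characteristic function of R is computed by a program.  The
-- disjunction is classically the pair R xs → f xs ≡ 1, ¬ R xs → f xs ≡ 0.
Computable : ∀ {k} → Pred (Vec ℕ k) 0ℓ → Set
Computable {k} R = Σ (μRec k) λ f → ∀ xs →
  (R xs × f [ xs ]⇓ 1) ⊎ (¬ R xs × f [ xs ]⇓ 0)

unary : Pred ℕ 0ℓ → Pred (Vec ℕ 1) 0ℓ
unary A xs = A (lookup xs zero)

binary : Rel ℕ 0ℓ → Pred (Vec ℕ 2) 0ℓ
binary R xs = R (lookup xs zero) (lookup xs (suc zero))

CE : Pred ℕ 0ℓ → Set
CE W = ∃ λ φ → W ≐ dom φ

mutual

  data Σ⁰ : ∀ {k} → ℕ → Pred (Vec ℕ k) 0ℓ → Set₁ where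
    base : ∀ {k} {R : Pred (Vec ℕ k) 0ℓ} → Computable R → Σ⁰ 0 R
    ex   : ∀ {k n} {R : Pred (Vec ℕ k) 0ℓ} {S : Pred (Vec ℕ (suc k)) 0ℓ} →
           Π⁰ n S → (∀ xs → R xs ⇔ (∃ λ y → S (y ∷ xs))) → Σ⁰ (suc n) R

  data Π⁰ : ∀ {k} → ℕ → Pred (Vec ℕ k) 0ℓ → Set₁ where
    base : ∀ {k} {R : Pred (Vec ℕ k) 0ℓ} → Computable R → Π⁰ 0 R
    all  : ∀ {k n} {R : Pred (Vec ℕ k) 0ℓ} {S : Pred (Vec ℕ (suc k)) 0ℓ} →
           Σ⁰ n S → (∀ xs → R xs ⇔ (∀ y → S (y ∷ xs))) → Π⁰ (suc n) R

Δ⁰ : ℕ → Pred ℕ 0ℓ → Set₁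
Δ⁰ n A = Σ⁰ n (unary A) × Π⁰ n (unary A)

Finite : Pred ℕ 0ℓ → Set
Finite X = ∃ λ (xs : List ℕ) → X ≐ (List._∈ xs)

infix 4 _⊆*_

_⊆*_ : Pred ℕ 0ℓ → Pred ℕ 0ℓ → Set
X ⊆* Y = Finite (X ∖ Y)

record Cohesive (C : Pred ℕ 0ℓ) : Set₁ where
  field
    infinite : ¬ Finite C
    cohesive : ∀ (W : Pred ℕ 0ℓ) → CE W → (C ⊆* W) ⊎ (C ⊆* ∁ W)

infix 4 _≅_

_≅_ : ∀ {a b ℓ₁ ℓ₂ ℓ₃ ℓ₄} →
      RawRelation a ℓ₁ ℓ₂ → RawRelation b ℓ₃ ℓ₄ →
      Set (a ⊔ b ⊔ ℓ₁ ⊔ ℓ₂ ⊔ ℓ₃ ⊔ ℓ₄)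
A ≅ B = ∃ (IsOrderIsomorphism A._≈_ B._≈_ A._∼_ B._∼_)
  where
  module A = RawRelation A
  module B = RawRelation B

record ComputableLinearOrder : Set₁ where
  infix 4 _≺_
  field
    L            : Pred ℕ 0ℓ
    _≺_          : Rel ℕ 0ℓ
    L-nonempty   : ∃ λ x → x ∈ L
    L-computable : Computable (unary L)
    ≺-on-L       : ∀ {x y} → x ≺ y → x ∈ L × y ∈ L
    ≺-computable : Computable (binary _≺_)
    isStrictTotalOrder :
      IsStrictTotalOrder {A = Σ ℕ L} (_≡_ on proj₁) (_≺_ on proj₁)

  order : RawRelation 0ℓ 0ℓ 0ℓ
  order = record
    { Carrier = Σ ℕ L ; _≈_ = _≡_ on proj₁ ; _∼_ = _≺_ on proj₁ }

ω η : StrictTotalOrder 0ℓ 0ℓ 0ℓ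
ω = ℕ.<-strictTotalOrder
η = ℚ.<-strictTotalOrder

infixl 6 _⊕_

_⊕_ : StrictTotalOrder 0ℓ 0ℓ 0ℓ → StrictTotalOrder 0ℓ 0ℓ 0ℓ →
      StrictTotalOrder 0ℓ 0ℓ 0ℓ
_⊕_ = ⊎-<-strictTotalOrder {d = 0ℓ} {e = 0ℓ} {f = 0ℓ}

⌊_⌋ : StrictTotalOrder 0ℓ 0ℓ 0ℓ → RawRelation 0ℓ 0ℓ 0ℓ
⌊ A ⌋ = record { Carrier = A.Carrier ; _≈_ = A._≈_ ; _∼_ = A._<_ }
  where module A = StrictTotalOrder A

IsCopyOfω : ComputableLinearOrder → Set
IsCopyOfω 𝓛 = ComputableLinearOrder.order 𝓛 ≅ ⌊ ω ⌋

module _ (C : Pred ℕ 0ℓ) (𝓛 : ComputableLinearOrder) where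

  open ComputableLinearOrder 𝓛

  -- Elements are represented by programs; distinct programs for the same
  -- partial function are identified by _=C_.
  record D : Set where
    field
      φ       : μRec 1
      values  : ∀ {n m} → φ ⟨ n ⟩↓= m → m ∈ L
      defined : C ⊆* dom φ

  open D

  _=C_ : Rel D 0ℓ
  p =C q = C ⊆* λ n → ∃ λ m → φ p ⟨ n ⟩↓= m × φ q ⟨ n ⟩↓= m

  _≺C_ : Rel D 0ℓ
  p ≺C q = C ⊆* λ n → ∃ λ l → ∃ λ m →
    φ p ⟨ n ⟩↓= l × φ q ⟨ n ⟩↓= m × l ≺ m

  -- The quotient of D by _=C_ is the setoid (D , _=C_).
  cohesivePower : RawRelation 0ℓ 0ℓ 0ℓ
  cohesivePower = record { Carrier = D ; _≈_ = _=C_ ; _∼_ = _≺C_ }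

{-# OPTIONS --safe #-}

-- Every rational v ≥ 0 is a potential element of 𝓛, and it enters 𝓛 at the
-- first stage (from its code on) at which a program with key at most v is seen
-- to halt, each key k also causing one entry of its own.  Only finitely many
-- elements lie below a given one, so 𝓛 ≅ ω, while a pair a ≺ b with nothing in
-- between certifies that no program with key at most the value of a halts after
-- a stage computable from a and b.
--
-- In the cohesive power the constants form an initial segment ω and the rest has
-- no endpoints.  The rest is dense: otherwise there are φ, ψ with ψ n the successor
-- of φ n for almost all n in C, and φ n unbounded in 𝓛.  If n ∈ C ⇔ ∃ y ∀ z T z y n,
-- then φ n and ψ n settle, for more and more n′ and y, whether the search for a z
-- with ¬ T z y n′ ever halts; let next n be the largest n′ < n that is thereby
-- verified to be in C.  The length of the chain n, next n, next (next n), … is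
-- partial computable, and its parity differs at n and next n, both of which lie
-- in C and tend to infinity.  So the c.e. set of n with even length splits C,
-- against cohesiveness.  A countable dense order without endpoints is η.
module Submission where

open import Axiom.ExcludedMiddle using (ExcludedMiddle)
open import Data.Empty using (⊥; ⊥-elim)
open import Data.Fin.Base using (Fin; fromℕ<; suc; toℕ; zero)
open import Data.Fin.Patterns
import Data.Fin.Properties as Fin
import Data.Integer.Base as ℤ
open import Data.List.Base using (List; filter; upTo)
open import Data.List.Extrema.Nat using (max; xs≤max)
open import Data.List.Membership.Propositional.Properties using (∈-filter⁺; ∈-filter⁻; ∈-upTo⁺)
import Data.List.Relation.Unary.All as All
open import Data.Maybe.Base using (Maybe; just; nothing)
open import Data.Nat.Base hiding (compare)
open import Data.Nat.Induction using (<-rec)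
open import Data.Nat.Properties
open import Data.Product.Base using (_,_; _×_; proj₁; proj₂; swap; Σ; ∃)
import Data.Rational.Base as ℚ
import Data.Rational.Properties as ℚ
open import Data.Sum.Base using (_⊎_; inj₁; inj₂)
open import Data.Sum.Relation.Binary.LeftOrder using (₁∼₁; ₁∼₂; ₂∼₂)
import Data.Sum.Relation.Binary.Pointwise as ⊎
open import Data.Unit.Base using (tt; ⊤)
open import Data.Vec.Base using (Vec; []; _∷_; lookup; tabulate)
open import Data.Vec.Properties using (tabulate∘lookup)
open import Defs
open import Function.Base using (_on_; _∘_; id)
open import Function.Bundles using (Equivalence; _⇔_; mk⇔)
open import Level using (0ℓ)
open import Relation.Binary.Bundles using (StrictTotalOrder)
open import Relation.Binary.Definitions using (Tri; Trichotomous; tri<; tri>; tri≈)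
open import Relation.Binary.Morphism.Structures using (IsOrderIsomorphism)
open import Relation.Binary.PropositionalEquality
open import Relation.Binary.Structures using (IsStrictTotalOrder)
open import Relation.Nullary using (Dec; _×-dec_; no; yes; ¬_)
open import Relation.Unary using (Pred; _∈_; _∖_)
open import Algebra.Properties.CommutativeSemigroup *-commutativeSemigroup using (xy∙z≈xz∙y)

-- Computable functions and decidable formulas

-- The combinators below build function, program and correctness proof together, so total computable
-- functions come with verified programs.
record Fun (k : ℕ) : Set where
  constructor mkFun
  field
    fun     : Vec ℕ k → ℕ
    prog    : μRec k
    correct : ∀ xs → prog [ xs ]⇓ fun xs

open Fun public

retype : ∀ {k} (f : Fun k) (g : Vec ℕ k → ℕ) → (∀ xs → fun f xs ≡ g xs) → Fun k
retype f g f≡g = mkFun g (prog f) λ xs → subst (prog f [ xs ]⇓_) (f≡g xs) (correct f xs)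

funs : ∀ {k m} → Vec (Fun k) m → Vec ℕ k → Vec ℕ m
funs []       xs = []
funs (f ∷ fs) xs = fun f xs ∷ funs fs xs

progs : ∀ {k m} → Vec (Fun k) m → Vec (μRec k) m
progs []       = []
progs (f ∷ fs) = prog f ∷ progs fs

corrects : ∀ {k m} (fs : Vec (Fun k) m) xs → progs fs [ xs ]⇓* funs fs xs
corrects []       xs = []
corrects (f ∷ fs) xs = correct f xs ∷ corrects fs xs

infixl 9 _⟪_⟫

_⟪_⟫ : ∀ {k m} → Fun m → Vec (Fun k) m → Fun k
f ⟪ gs ⟫ = mkFun (λ xs → fun f (funs gs xs)) (comp (prog f) (progs gs))
  λ xs → comp (corrects gs xs) (correct f _)

var : ∀ {k} → Fin k → Fun k
var i = mkFun (λ xs → lookup xs i) (proj i) λ _ → proj i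

sucF : Fun 1
sucF = mkFun (λ { (x ∷ []) → suc x }) suc λ { (x ∷ []) → suc }

lit : ∀ {k} → ℕ → Fun k
lit {k} n = mkFun (λ _ → n) (numeral n) (converges n)
  where
  numeral : ℕ → μRec k
  numeral zero    = comp zero []
  numeral (suc n) = comp suc (numeral n ∷ [])
  converges : ∀ n xs → numeral n [ xs ]⇓ n
  converges zero    xs = comp [] zero
  converges (suc n) xs = comp (converges n xs ∷ []) suc

natrec : ℕ → (ℕ → ℕ → ℕ) → ℕ → ℕ
natrec z s zero    = z
natrec z s (suc n) = s n (natrec z s n)

rec : ∀ {k} → Fun k → Fun (2 + k) → Fun (1 + k)
rec {k} f g = mkFun val (prec (prog f) (prog g)) ok
  where
  val : Vec ℕ (1 + k) → ℕ
  val (n ∷ xs) = natrec (fun f xs) (λ i r → fun g (i ∷ r ∷ xs)) n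
  ok : ∀ xs → prec (prog f) (prog g) [ xs ]⇓ val xs
  ok (zero  ∷ xs) = prec₀ (correct f xs)
  ok (suc n ∷ xs) = precₛ (ok (n ∷ xs)) (correct g _)

predF : Fun 1
predF = retype (rec (lit 0) (var 0F)) (λ { (x ∷ []) → pred x })
  λ { (zero ∷ []) → refl ; (suc x ∷ []) → refl }

addF mulF monusF : Fun 2
addF = retype (rec (var 0F) (sucF ⟪ var 1F ∷ [] ⟫)) (λ { (x ∷ y ∷ []) → x + y })
  λ { (x ∷ y ∷ []) → go x y }
  where
  go : ∀ x y → natrec y (λ _ → suc) x ≡ x + y
  go zero    y = refl
  go (suc x) y = cong suc (go x y)
mulF = retype (rec (lit 0) (addF ⟪ var 2F ∷ var 1F ∷ [] ⟫)) (λ { (x ∷ y ∷ []) → x * y })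
  λ { (x ∷ y ∷ []) → go x y }
  where
  go : ∀ x y → natrec 0 (λ _ r → y + r) x ≡ x * y
  go zero    y = refl
  go (suc x) y = cong (y +_) (go x y)
monusF = retype (rec (var 0F) (predF ⟪ var 1F ∷ [] ⟫) ⟪ var 1F ∷ var 0F ∷ [] ⟫)
  (λ { (x ∷ y ∷ []) → x ∸ y }) λ { (x ∷ y ∷ []) → go x y }
  where
  go : ∀ x y → natrec x (λ _ → pred) y ≡ x ∸ y
  go x zero    = refl
  go x (suc y) = trans (cong pred (go x y)) (pred[m∸n]≡m∸[1+n] x y)

case₀ : ℕ → ℕ → ℕ → ℕ
case₀ zero    x y = x
case₀ (suc _) x y = y

caseF : Fun 3
caseF = retype (rec (var 0F) (var 3F)) (λ { (c ∷ x ∷ y ∷ []) → case₀ c x y })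
  λ { (zero ∷ x ∷ y ∷ []) → refl ; (suc c ∷ x ∷ y ∷ []) → refl }

infixl 7 _+ᶠ_ _∸ᶠ_
infixl 8 _*ᶠ_

_+ᶠ_ _*ᶠ_ _∸ᶠ_ : ∀ {k} → Fun k → Fun k → Fun k
f +ᶠ g = addF ⟪ f ∷ g ∷ [] ⟫
f *ᶠ g = mulF ⟪ f ∷ g ∷ [] ⟫
f ∸ᶠ g = monusF ⟪ f ∷ g ∷ [] ⟫

sucᶠ predᶠ : ∀ {k} → Fun k → Fun k
sucᶠ f = sucF ⟪ f ∷ [] ⟫
predᶠ f = predF ⟪ f ∷ [] ⟫

caseᶠ : ∀ {k} → Fun k → Fun k → Fun k → Fun k
caseᶠ f g h = caseF ⟪ f ∷ g ∷ h ∷ [] ⟫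

Tests : Set → ℕ → Set
Tests P c = (P × c ≡ 1) ⊎ (¬ P × c ≡ 0)

-- `truth` is an arbitrary type rather than an equation about `char`, so a formula built from the
-- connectives unfolds to the very predicate that the proofs use.
record Fm (k : ℕ) : Set₁ where
  constructor mkFm
  field
    truth  : Vec ℕ k → Set
    char   : Fun k
    decide : ∀ xs → Tests (truth xs) (fun char xs)

open Fm public

infixr 5 ¬ᶠ_
infix  6 _≤ᶠ_ _<ᶠ_ _≡ᶠ_
infixr 4 _∧ᶠ_
infixr 3 _∨ᶠ_
infixr 2 _→ᶠ_

_≤ᶠ_ : ∀ {k} → Fun k → Fun k → Fm k
f ≤ᶠ g = mkFm (λ xs → fun f xs ≤ fun g xs) (lit 1 ∸ᶠ (f ∸ᶠ g)) λ xs → go (fun f xs) (fun g xs)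
  where
  go : ∀ a b → Tests (a ≤ b) (1 ∸ (a ∸ b))
  go a b with a ≤? b
  ... | yes a≤b rewrite m≤n⇒m∸n≡0 a≤b = inj₁ (a≤b , refl)
  ... | no  a≰b = inj₂ (a≰b , m≤n⇒m∸n≡0 (m<n⇒0<n∸m (≰⇒> a≰b)))

_<ᶠ_ : ∀ {k} → Fun k → Fun k → Fm k
f <ᶠ g = sucᶠ f ≤ᶠ g

¬ᶠ_ : ∀ {k} → Fm k → Fm k
¬ᶠ P = mkFm (λ xs → ¬ truth P xs) (lit 1 ∸ᶠ char P) λ xs → go (decide P xs)
  where
  go : ∀ {A c} → Tests A c → Tests (¬ A) (1 ∸ c)
  go (inj₁ (p , refl)) = inj₂ ((λ ¬p → ¬p p) , refl)
  go (inj₂ (p , refl)) = inj₁ (p , refl)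

_∧ᶠ_ : ∀ {k} → Fm k → Fm k → Fm k
P ∧ᶠ Q = mkFm (λ xs → truth P xs × truth Q xs) (char P *ᶠ char Q)
  λ xs → go (decide P xs) (decide Q xs)
  where
  go : ∀ {A B c d} → Tests A c → Tests B d → Tests (A × B) (c * d)
  go (inj₁ (p , refl)) (inj₁ (q , refl)) = inj₁ ((p , q) , refl)
  go (inj₁ (p , refl)) (inj₂ (q , refl)) = inj₂ ((λ x → q (proj₂ x)) , refl)
  go (inj₂ (p , refl)) _                 = inj₂ ((λ x → p (proj₁ x)) , refl)

restate : ∀ {k} (P : Fm k) (T : Vec ℕ k → Set) → (∀ xs → truth P xs → T xs) →
          (∀ xs → T xs → truth P xs) → Fm k
restate P T to from = mkFm T (char P) λ xs → go (to xs) (from xs) (decide P xs)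
  where
  go : ∀ {A B c} → (A → B) → (B → A) → Tests A c → Tests B c
  go f g (inj₁ (p , e)) = inj₁ (f p , e)
  go f g (inj₂ (p , e)) = inj₂ ((λ t → p (g t)) , e)

stable : ∀ {k} (P : Fm k) xs → ¬ ¬ truth P xs → truth P xs
stable P xs ¬¬p with decide P xs
... | inj₁ (p , _) = p
... | inj₂ (p , _) = ⊥-elim (¬¬p p)

truth? : ∀ {k} (P : Fm k) xs → Dec (truth P xs)
truth? P xs with decide P xs
... | inj₁ (p , _) = yes p
... | inj₂ (p , _) = no p

_→ᶠ_ _∨ᶠ_ : ∀ {k} → Fm k → Fm k → Fm k
P →ᶠ Q = restate (¬ᶠ (P ∧ᶠ ¬ᶠ Q)) (λ xs → truth P xs → truth Q xs)
  (λ xs f p → stable Q xs λ ¬q → f (p , ¬q)) (λ xs f pq → proj₂ pq (f (proj₁ pq)))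
P ∨ᶠ Q = restate (¬ᶠ (¬ᶠ P ∧ᶠ ¬ᶠ Q)) (λ xs → truth P xs ⊎ truth Q xs)
  (λ xs f → go (truth? P xs) (truth? Q xs) f)
  λ { xs (inj₁ p) f → proj₁ f p ; xs (inj₂ q) f → proj₂ f q }
  where
  go : ∀ {A B : Set} → Dec A → Dec B → ¬ (¬ A × ¬ B) → A ⊎ B
  go (yes p) _       f = inj₁ p
  go (no _)  (yes q) f = inj₂ q
  go (no ¬p) (no ¬q) f = ⊥-elim (f (¬p , ¬q))

_≡ᶠ_ : ∀ {k} → Fun k → Fun k → Fm k
f ≡ᶠ g = restate (f ≤ᶠ g ∧ᶠ g ≤ᶠ f) (λ xs → fun f xs ≡ fun g xs)
  (λ xs le → ≤-antisym (proj₁ le) (proj₂ le)) (λ xs eq → ≤-reflexive eq , ≤-reflexive (sym eq))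

select : ∀ {k m} → (Fin m → Fin k) → Vec (Fun k) m
select ρ = tabulate λ i → var (ρ i)

funs-select : ∀ {k m} (ρ : Fin m → Fin k) xs → funs (select ρ) xs ≡ tabulate λ i → lookup xs (ρ i)
funs-select {m = zero}  ρ xs = refl
funs-select {m = suc m} ρ xs = cong (lookup xs (ρ 0F) ∷_) (funs-select (λ i → ρ (suc i)) xs)

below-suc : ∀ {Q : ℕ → Set} {n} → (∀ i → i < n → Q i) → Q n → ∀ i → i < suc n → Q i
below-suc below at i (s≤s i≤n) with m≤n⇒m<n∨m≡n i≤n
... | inj₁ i<n  = below i i<n
... | inj₂ refl = at

-- The characteristic value is the product of those of the instances below the bound, which is 1
-- just if none of them is 0.
all< : ∀ {k} → Fun k → Fm (suc k) → Fm k
all< {k} f P = mkFm (λ xs → ∀ i → i < fun f xs → truth P (i ∷ xs))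
  (retype (rec (lit 1) (var 1F *ᶠ char P ⟪ var 0F ∷ select (λ i → suc (suc i)) ⟫)
             ⟪ f ∷ select (λ i → i) ⟫)
          (λ xs → prod xs (fun f xs)) prod-ok)
  λ xs → go xs (fun f xs)
  where
  prod : Vec ℕ k → ℕ → ℕ
  prod xs = natrec 1 λ i r → r * fun (char P) (i ∷ xs)
  prod-ok : ∀ xs → _
  prod-ok xs = trans (cong (λ ys → natrec′ ys (fun f xs)) (trans (funs-select (λ i → i) xs) (tabulate∘lookup xs)))
    (natrec′-ok (fun f xs))
    where
    natrec′ : Vec ℕ k → ℕ → ℕ
    natrec′ ys = natrec 1 λ i r → r * fun (char P) (i ∷ funs (select λ j → suc (suc j)) (i ∷ r ∷ ys))
    natrec′-ok : ∀ n → natrec′ xs n ≡ prod xs n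
    natrec′-ok zero = refl
    natrec′-ok (suc n) = cong₂ _*_ (natrec′-ok n) (cong (λ ys → fun (char P) (n ∷ ys))
      (trans (funs-select (λ j → suc (suc j)) (n ∷ natrec′ xs n ∷ xs)) (tabulate∘lookup xs)))
  go : ∀ xs n → ((∀ i → i < n → truth P (i ∷ xs)) × prod xs n ≡ 1) ⊎
                (¬ (∀ i → i < n → truth P (i ∷ xs)) × prod xs n ≡ 0)
  go xs zero = inj₁ ((λ _ ()) , refl)
  go xs (suc n) with go xs n | decide P (n ∷ xs)
  ... | inj₁ (p , e) | inj₁ (q , e′) rewrite e | e′ = inj₁ (below-suc p q , refl)
  ... | inj₁ (p , e) | inj₂ (q , e′) rewrite e | e′ = inj₂ ((λ h → q (h n ≤-refl)) , refl)
  ... | inj₂ (p , e) | _ rewrite e = inj₂ ((λ h → p λ i i<n → h i (m<n⇒m<1+n i<n)) , refl)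

ex< : ∀ {k} → Fun k → Fm (suc k) → Fm k
ex< {k} f₀ P = restate (¬ᶠ all< f₀ (¬ᶠ P)) (λ xs → ∃ λ i → i < fun f₀ xs × truth P (i ∷ xs))
  (λ xs f → to f (search xs (fun f₀ xs))) λ { xs (i , i<n , p) f → f i i<n p }
  where
  search : ∀ xs n → Dec (∃ λ i → i < n × truth P (i ∷ xs))
  search xs zero = no λ ()
  search xs (suc n) with truth? P (n ∷ xs) | search xs n
  ... | yes p | _ = yes (n , ≤-refl , p)
  ... | no  _ | yes (i , i<n , p) = yes (i , m<n⇒m<1+n i<n , p)
  ... | no ¬p | no none = no λ { (i , s≤s i≤n , p) → case i i≤n p (m≤n⇒m<n∨m≡n i≤n) }
    where
    case : ∀ i → i ≤ n → truth P (i ∷ xs) → i < n ⊎ i ≡ n → ⊥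
    case i _ p (inj₁ i<n)  = none (i , i<n , p)
    case i _ p (inj₂ refl) = ¬p p
  to : ∀ {n} {xs : Vec ℕ k} → ¬ (∀ i → i < n → ¬ truth P (i ∷ xs)) →
       Dec (∃ λ i → i < n × truth P (i ∷ xs)) → ∃ λ i → i < n × truth P (i ∷ xs)
  to f (yes w)   = w
  to f (no none) = ⊥-elim (f λ i i<n p → none (i , i<n , p))

substᶠ : ∀ {k m} → Fm m → Vec (Fun k) m → Fm k
substᶠ P fs = mkFm (λ xs → truth P (funs fs xs)) (char P ⟪ fs ⟫) λ xs → decide P (funs fs xs)

Fm-computable : ∀ {k} (P : Fm k) → Computable (truth P)
Fm-computable P = prog (char P) , λ xs → go (decide P xs) (correct (char P) xs)
  where
  go : ∀ {A c xs} → Tests A c → prog (char P) [ xs ]⇓ c →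
       (A × prog (char P) [ xs ]⇓ 1) ⊎ (¬ A × prog (char P) [ xs ]⇓ 0)
  go (inj₁ (p , refl)) h = inj₁ (p , h)
  go (inj₂ (p , refl)) h = inj₂ (p , h)

-- Pairing

-- The integer square root: it goes up by one exactly when the next square is reached.
root : ℕ → ℕ
root = natrec 0 λ n r → case₀ (suc r * suc r ∸ suc n) (suc r) r

root-bounds : ∀ n → root n * root n ≤ n × n < suc (root n) * suc (root n)
root-bounds zero = z≤n , s≤s z≤n
root-bounds (suc n) with root n | root-bounds n
... | r | lo , hi with suc r * suc r ∸ suc n in eq
...   | zero  = m∸n≡0⇒m≤n eq , ≤-trans (s≤s hi)
          (*-mono-< (n<1+n (suc r)) (n<1+n (suc r)))
...   | suc _ = m≤n⇒m≤1+n lo , (≤∧≢⇒< hi λ e → 1+n≢0 (trans (sym eq) (m≤n⇒m∸n≡0 (≤-reflexive (sym e)))))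

root-unique : ∀ {n} s → s * s ≤ n → n < suc s * suc s → root n ≡ s
root-unique {n} s lo hi with <-cmp (root n) s | root-bounds n
... | tri≈ _ e _ | _ = e
... | tri< r<s _ _ | _ , hi′ = ⊥-elim (<-irrefl refl (<-≤-trans hi′ (≤-trans (*-mono-≤ r<s r<s) lo)))
... | tri> _ _ s<r | lo′ , _ = ⊥-elim (<-irrefl refl (<-≤-trans hi (≤-trans (*-mono-≤ s<r s<r) lo′)))

rootF : Fun 1
rootF = retype (rec (lit 0) (caseᶠ (sucᶠ (var 1F) *ᶠ sucᶠ (var 1F) ∸ᶠ sucᶠ (var 0F)) (sucᶠ (var 1F)) (var 1F)))
  (λ { (n ∷ []) → root n }) λ { (n ∷ []) → refl }

opaque

  -- As `x ≤ x + y`, the value lies between the square of `x + y` and the next square, so `root`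
  -- recovers `x + y`. Not every number is a pair.
  pair : ℕ → ℕ → ℕ
  pair x y = (x + y) * (x + y) + x

  fst snd : ℕ → ℕ
  fst n = n ∸ root n * root n
  snd n = root n ∸ fst n

  private
    root-pair : ∀ x y → root (pair x y) ≡ x + y
    root-pair x y = root-unique (x + y) (m≤m+n _ x)
      (s≤s (begin
        s * s + x        ≤⟨ +-monoʳ-≤ (s * s) (m≤m+n x y) ⟩
        s * s + s        ≡⟨ +-comm (s * s) s ⟩
        s + s * s        ≡⟨ *-suc s s ⟨
        s * suc s        ≤⟨ m≤n+m (s * suc s) s ⟩
        s + s * suc s    ∎))
      where
      open ≤-Reasoning
      s : ℕ
      s = x + y

  fst-pair : ∀ x y → fst (pair x y) ≡ x
  fst-pair x y rewrite root-pair x y = m+n∸m≡n ((x + y) * (x + y)) x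

  snd-pair : ∀ x y → snd (pair x y) ≡ y
  snd-pair x y = trans (cong₂ _∸_ (root-pair x y) (fst-pair x y)) (m+n∸m≡n x y)

  fst≤ : ∀ n → fst n ≤ n
  fst≤ n = m∸n≤m n (root n * root n)

  x≤pair : ∀ x y → x ≤ pair x y
  x≤pair x y = m≤n+m x ((x + y) * (x + y))

  private
    m≤m*m : ∀ m → m ≤ m * m
    m≤m*m zero    = z≤n
    m≤m*m (suc m) = m≤m*n (suc m) (suc m)

  y≤pair : ∀ x y → y ≤ pair x y
  y≤pair x y = ≤-trans (m≤n+m y x) (≤-trans (m≤m*m (x + y)) (m≤m+n _ x))

  pair-mono-≤ : ∀ {x x′ y y′} → x ≤ x′ → y ≤ y′ → pair x y ≤ pair x′ y′
  pair-mono-≤ x≤ y≤ = +-mono-≤ (*-mono-≤ (+-mono-≤ x≤ y≤) (+-mono-≤ x≤ y≤)) x≤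

  pair-prog : μRec 2
  pair-prog = prog ((var 0F +ᶠ var 1F) *ᶠ (var 0F +ᶠ var 1F) +ᶠ var 0F)

  pair-correct : ∀ x y → pair-prog [ x ∷ y ∷ [] ]⇓ pair x y
  pair-correct x y = correct ((var 0F +ᶠ var 1F) *ᶠ (var 0F +ᶠ var 1F) +ᶠ var 0F) _

  private
    fst-fun snd-fun : Fun 1
    fst-fun = var 0F ∸ᶠ rootF ⟪ var 0F ∷ [] ⟫ *ᶠ rootF ⟪ var 0F ∷ [] ⟫
    snd-fun = rootF ⟪ var 0F ∷ [] ⟫ ∸ᶠ fst-fun

  fst-prog snd-prog : μRec 1
  fst-prog = prog fst-fun
  snd-prog = prog snd-fun

  fst-correct : ∀ x → fst-prog [ x ∷ [] ]⇓ fst x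
  fst-correct x = correct fst-fun (x ∷ [])

  snd-correct : ∀ x → snd-prog [ x ∷ [] ]⇓ snd x
  snd-correct x = correct snd-fun (x ∷ [])

pairᶠ : ∀ {k} → Fun k → Fun k → Fun k
pairᶠ f g = mkFun (λ { (x ∷ y ∷ []) → pair x y }) pair-prog (λ { (x ∷ y ∷ []) → pair-correct x y }) ⟪ f ∷ g ∷ [] ⟫

fstᶠ sndᶠ : ∀ {k} → Fun k → Fun k
fstᶠ f = mkFun (λ { (x ∷ []) → fst x }) fst-prog (λ { (x ∷ []) → fst-correct x }) ⟪ f ∷ [] ⟫
sndᶠ f = mkFun (λ { (x ∷ []) → snd x }) snd-prog (λ { (x ∷ []) → snd-correct x }) ⟪ f ∷ [] ⟫

-- A universal machine

-- The successor reserves 0 for the empty stack, at which `step` stays put: the machine has halted.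
push : ℕ → ℕ → ℕ
push i K = suc (pair i K)

-- A configuration pairs a stack of pending instructions with a current value. Tags 7 and 8 are the
-- return frames of tag 5: the first keeps the second program and the original input, the second
-- keeps the first result. A loop, tag 6, pushes itself back as `i`.
act : (tag arg K v i : ℕ) → ℕ
act 0 a K v i = pair K 0
act 1 a K v i = pair K (suc v)
act 2 a K v i = pair K (fst v)
act 3 a K v i = pair K (snd v)
act 4 a K v i = pair (push (snd a) (push (fst a) K)) v
act 5 a K v i = pair (push (fst a) (push (pair 7 (pair (snd a) v)) K)) v
act 6 a K v i = case₀ (fst v) (pair K (snd v)) (pair (push a (push i K)) v)
act 7 a K v i = pair (push (fst a) (push (pair 8 v) K)) (snd a)
act 8 a K v i = pair K (pair a v)
act _ a K v i = pair K (pred v)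

actF : Fun 5
actF = retype
  (branch 0 (pairᶠ K (lit 0)) (branch 1 (pairᶠ K (sucᶠ v)) (branch 2 (pairᶠ K (fstᶠ v)) (branch 3 (pairᶠ K (sndᶠ v))
  (branch 4 (pairᶠ (pushᶠ (sndᶠ a) (pushᶠ (fstᶠ a) K)) v)
  (branch 5 (pairᶠ (pushᶠ (fstᶠ a) (pushᶠ (pairᶠ (lit 7) (pairᶠ (sndᶠ a) v)) K)) v)
  (branch 6 (caseᶠ (fstᶠ v) (pairᶠ K (sndᶠ v)) (pairᶠ (pushᶠ a (pushᶠ i K)) v))
  (branch 7 (pairᶠ (pushᶠ (fstᶠ a) (pushᶠ (pairᶠ (lit 8) v) K)) (sndᶠ a))
  (branch 8 (pairᶠ K (pairᶠ a v)) (pairᶠ K (predᶠ v)))))))))))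
  (λ { (t ∷ a ∷ K ∷ v ∷ i ∷ []) → act t a K v i })
  λ { (t ∷ a ∷ K ∷ v ∷ i ∷ []) → ok t a K v i }
  where
  a K v i : Fun 5
  a = var 1F
  K = var 2F
  v = var 3F
  i = var 4F
  pushᶠ : Fun 5 → Fun 5 → Fun 5
  pushᶠ f g = sucᶠ (pairᶠ f g)
  branch : ℕ → Fun 5 → Fun 5 → Fun 5
  branch n f g = caseᶠ (var 0F ∸ᶠ lit n) f g
  ok : ∀ t a K v i → _
  ok 0 a K v i = refl
  ok 1 a K v i = refl
  ok 2 a K v i = refl
  ok 3 a K v i = refl
  ok 4 a K v i = refl
  ok 5 a K v i = refl
  ok 6 a K v i = refl
  ok 7 a K v i = refl
  ok 8 a K v i = refl
  ok (suc (suc (suc (suc (suc (suc (suc (suc (suc t))))))))) a K v i = refl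

step : ℕ → ℕ
step c = case₀ (fst c) c
  (act (fst i) (snd i) (snd (pred (fst c))) (snd c) i)
  where
  i : ℕ
  i = fst (pred (fst c))

stepF : Fun 1
stepF = retype
  (caseᶠ (fstᶠ c) c (actF ⟪ fstᶠ i ∷ sndᶠ i ∷ sndᶠ (predᶠ (fstᶠ c)) ∷ sndᶠ c ∷ i ∷ [] ⟫))
  (λ { (c ∷ []) → step c }) λ { (c ∷ []) → refl }
  where
  c i : Fun 1
  c = var 0F
  i = fstᶠ (predᶠ (fstᶠ c))

step-act : ∀ t a K v → step (pair (push (pair t a) K) v) ≡ act t a K v (pair t a)
step-act t a K v
  rewrite fst-pair (push (pair t a) K) v | snd-pair (push (pair t a) K) v
        | fst-pair (pair t a) K | snd-pair (pair t a) K
        | fst-pair t a | snd-pair t a = refl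

data _↠_ : ℕ → ℕ → Set where
  done : ∀ {c} → c ↠ c
  _◅_  : ∀ {c c′ d} → step c ≡ c′ → c′ ↠ d → c ↠ d

infixr 5 _◅_ _◅◅_

_◅◅_ : ∀ {c d e} → c ↠ d → d ↠ e → c ↠ e
done      ◅◅ r = r
(e ◅ r′) ◅◅ r = e ◅ (r′ ◅◅ r)

infix 4 _∶_⇒_

-- Instruction i turns the value v into w, whatever the stack below.
_∶_⇒_ : ℕ → ℕ → ℕ → Set
i ∶ v ⇒ w = ∀ K → pair (push i K) v ↠ pair K w

iZero iSuc iFst iSnd iPred iId : ℕ
iZero = pair 0 0
iSuc  = pair 1 0
iFst  = pair 2 0
iSnd  = pair 3 0
iPred = pair 9 0

iComp iPair : ℕ → ℕ → ℕ
iComp f g = pair 4 (pair f g)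
iPair f g = pair 5 (pair f g)

iId = iComp iPred iSuc

iWhile : ℕ → ℕ
iWhile f = pair 6 f

⇒zero : ∀ {v} → iZero ∶ v ⇒ 0
⇒zero {v} K = step-act 0 0 K v ◅ done

⇒suc : ∀ {v} → iSuc ∶ v ⇒ suc v
⇒suc {v} K = step-act 1 0 K v ◅ done

⇒fst : ∀ {v w} → iFst ∶ pair v w ⇒ v
⇒fst {v} {w} K = trans (step-act 2 0 K _) (cong (pair K) (fst-pair v w)) ◅ done

⇒snd : ∀ {v w} → iSnd ∶ pair v w ⇒ w
⇒snd {v} {w} K = trans (step-act 3 0 K _) (cong (pair K) (snd-pair v w)) ◅ done

⇒comp : ∀ {f g u v w} → g ∶ u ⇒ v → f ∶ v ⇒ w → iComp f g ∶ u ⇒ w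
⇒comp {f} {g} {u} Hg Hf K =
  trans (step-act 4 (pair f g) K u) (cong₂ (λ a b → pair (push a (push b K)) u) (snd-pair f g) (fst-pair f g))
  ◅ (Hg _ ◅◅ Hf K)

⇒pair : ∀ {f g u v w} → f ∶ u ⇒ v → g ∶ u ⇒ w → iPair f g ∶ u ⇒ pair v w
⇒pair {f} {g} {u} {v} {w} Hf Hg K =
  trans (step-act 5 (pair f g) K u) (cong₂ (λ a b → pair (push a (push (pair 7 (pair b u)) K)) u)
    (fst-pair f g) (snd-pair f g))
  ◅ (Hf _ ◅◅ trans (step-act 7 (pair g u) K v) (cong₂ (λ a b → pair (push a (push (pair 8 v) K)) b)
    (fst-pair g u) (snd-pair g u))
  ◅ (Hg _ ◅◅ step-act 8 v K w ◅ done))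

⇒exit : ∀ {f w} → iWhile f ∶ pair 0 w ⇒ w
⇒exit {f} {w} K = trans (step-act 6 f K _) (trans
  (cong (λ n → case₀ n (pair K (snd (pair 0 w))) (pair (push f (push (iWhile f) K)) (pair 0 w))) (fst-pair 0 w))
  (cong (pair K) (snd-pair 0 w))) ◅ done

⇒loop : ∀ {f n w v u} → f ∶ pair (suc n) w ⇒ v → iWhile f ∶ v ⇒ u → iWhile f ∶ pair (suc n) w ⇒ u
⇒loop {f} {n} {w} Hf Hw K =
  trans (step-act 6 f K _) (cong
    (λ m → case₀ m (pair K (snd (pair (suc n) w))) (pair (push f (push (iWhile f) K)) (pair (suc n) w))) (fst-pair (suc n) w))
  ◅ (Hf _ ◅◅ Hw K)

⟨_⟩ : ∀ {k} → Vec ℕ k → ℕ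
⟨ [] ⟩     = 0
⟨ x ∷ xs ⟩ = pair x ⟨ xs ⟩

iProj : ∀ {k} → Fin k → ℕ
iProj zero    = iFst
iProj (suc i) = iComp (iProj i) iSnd

⇒proj : ∀ {k} (i : Fin k) xs → iProj i ∶ ⟨ xs ⟩ ⇒ lookup xs i
⇒proj zero    (x ∷ xs) = ⇒fst
⇒proj (suc i) (x ∷ xs) = ⇒comp ⇒snd (⇒proj i xs)

iInit iBody : ℕ → ℕ → ℕ
iInit f g = iPair iFst (iPair iZero (iPair (iComp f iSnd) iSnd))
iBody f g = iPair (iComp iPred iFst) (iComp (iPair (iComp iSuc iFst) (iPair g (iComp iSnd iSnd))) iSnd)

iTest iNext : ℕ → ℕ
iTest f = iPair f iId
iNext f = iComp (iTest f) (iComp (iPair (iComp iSuc iFst) iSnd) iSnd)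

-- The loops keep  remaining , (index , accumulator , arguments)  for
-- primitive recursion and  test , (candidate , arguments)  for μ.
mutual
  ⌜_⌝ : ∀ {k} → μRec k → ℕ
  ⌜ zero ⌝      = iZero
  ⌜ suc ⌝       = iComp iSuc iFst
  ⌜ proj i ⌝    = iProj i
  ⌜ comp f gs ⌝ = iComp ⌜ f ⌝ ⌜ gs ⌝*
  ⌜ prec f g ⌝  = iComp (iComp iFst iSnd) (iComp (iWhile (iBody ⌜ f ⌝ ⌜ g ⌝)) (iInit ⌜ f ⌝ ⌜ g ⌝))
  ⌜ μ f ⌝       = iComp iFst (iComp (iWhile (iNext ⌜ f ⌝)) (iComp (iTest ⌜ f ⌝) (iPair iZero iId)))

  ⌜_⌝* : ∀ {k m} → Vec (μRec k) m → ℕ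
  ⌜ [] ⌝*     = iZero
  ⌜ g ∷ gs ⌝* = iPair ⌜ g ⌝ ⌜ gs ⌝*

⇒pred : ∀ {v} → iPred ∶ v ⇒ pred v
⇒pred {v} K = step-act 9 0 K v ◅ done

⇒id : ∀ {v} → iId ∶ v ⇒ v
⇒id = ⇒comp ⇒suc ⇒pred

⇒test : ∀ {f s y} → f ∶ s ⇒ y → iTest f ∶ s ⇒ pair y s
⇒test Hf = ⇒pair Hf ⇒id

-- Induction on the distance `d` from the candidate to `n`. The loop is entered with the test of its
-- candidate already computed, so the test value `t` is delivered along with the run.
⇒search : ∀ {f n X} → (∀ m → m < n → ∃ λ y → f ∶ pair m X ⇒ suc y) → f ∶ pair n X ⇒ 0 →
  ∀ d m → d + m ≡ n → ∃ λ t → f ∶ pair m X ⇒ t × iWhile (iNext f) ∶ pair t (pair m X) ⇒ pair n X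
⇒search below at zero    m refl = 0 , at , ⇒exit
⇒search below at (suc d) m eq
  with ⇒search below at d (suc m) (trans (+-suc d m) eq) | below m (subst (suc m ≤_) eq (s≤s (m≤n+m m d)))
... | t , Ht , Hw | y , Hy = suc y , Hy ,
  ⇒loop (⇒comp (⇒comp ⇒snd (⇒pair (⇒comp ⇒fst ⇒suc) ⇒snd)) (⇒test Ht)) Hw

mutual
  complete : ∀ {k} {f : μRec k} {xs y} → f [ xs ]⇓ y → ⌜ f ⌝ ∶ ⟨ xs ⟩ ⇒ y
  complete zero         = ⇒zero
  complete suc          = ⇒comp ⇒fst ⇒suc
  complete (proj {xs = xs} i) = ⇒proj i xs
  complete (comp Hs Hf) = ⇒comp (complete* Hs) (complete Hf)
  complete H@(prec₀ _)   = ⇒prec H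
  complete H@(precₛ _ _) = ⇒prec H
  complete (μ {n = n} below H) =
    let t , Ht , Hw = ⇒search (λ m m<n → let y , Hy = below m m<n in y , complete Hy) (complete H) n 0 (+-identityʳ n)
    in ⇒comp (⇒comp (⇒comp (⇒pair ⇒zero ⇒id) (⇒test Ht)) Hw) ⇒fst

  complete* : ∀ {k m} {gs : Vec (μRec k) m} {xs ys} → gs [ xs ]⇓* ys → ⌜ gs ⌝* ∶ ⟨ xs ⟩ ⇒ ⟨ ys ⟩
  complete* []       = ⇒zero
  complete* (H ∷ Hs) = ⇒pair (complete H) (complete* Hs)

  ⇒prec : ∀ {k} {f : μRec k} {g n xs y} → prec f g [ n ∷ xs ]⇓ y → ⌜ prec f g ⌝ ∶ ⟨ n ∷ xs ⟩ ⇒ y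
  ⇒prec {f = f} {g} {n} {xs} {y} H =
    let r₀ , H₀ , reach = unroll H
    in ⇒comp (⇒comp (⇒pair ⇒fst (⇒pair ⇒zero (⇒pair (⇒comp ⇒snd H₀) ⇒snd)))
                    (subst (λ e → iWhile (iBody ⌜ f ⌝ ⌜ g ⌝) ∶ pair e (pair 0 (pair r₀ ⟨ xs ⟩)) ⇒ pair n (pair y ⟨ xs ⟩))
        (+-identityʳ n) (reach 0 ⇒exit))) (⇒comp ⇒snd ⇒fst)

  -- A derivation for `prec` peels off the last round, while the loop begins with the first. Hence
  -- the statement prolongs an arbitrary later run backwards to index 0, with `d` rounds still to
  -- come.
  unroll : ∀ {k} {f : μRec k} {g n xs r} → prec f g [ n ∷ xs ]⇓ r →
    ∃ λ r₀ → ⌜ f ⌝ ∶ ⟨ xs ⟩ ⇒ r₀ ×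
      (∀ d {u} → iWhile (iBody ⌜ f ⌝ ⌜ g ⌝) ∶ pair d (pair n (pair r ⟨ xs ⟩)) ⇒ u →
                iWhile (iBody ⌜ f ⌝ ⌜ g ⌝) ∶ pair (n + d) (pair 0 (pair r₀ ⟨ xs ⟩)) ⇒ u)
  unroll (prec₀ H) = _ , complete H , λ d Hw → Hw
  unroll {f = f} {g} {suc n} {xs} (precₛ H H′) =
    let r₀ , H₀ , reach = unroll H
    in r₀ , H₀ , λ d {u} Hw →
      subst (λ e → iWhile (iBody ⌜ f ⌝ ⌜ g ⌝) ∶ pair e (pair 0 (pair r₀ ⟨ xs ⟩)) ⇒ u) (+-suc n d)
        (reach (suc d) (⇒loop (⇒pair (⇒comp ⇒fst ⇒pred)
          (⇒comp ⇒snd (⇒pair (⇒comp ⇒fst ⇒suc) (⇒pair (complete H′) (⇒comp ⇒snd ⇒snd))))) Hw))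

-- Stages of computations and halting

run : ℕ → ℕ → ℕ
run s k = natrec (pair (push (fst k) 0) (snd k)) (λ _ → step) s

runF : Fun 2
runF = retype (rec (pairᶠ (sucᶠ (pairᶠ (fstᶠ (var 0F)) (lit 0))) (sndᶠ (var 0F))) (stepF ⟪ var 1F ∷ [] ⟫))
  (λ { (s ∷ k ∷ []) → run s k }) λ { (s ∷ k ∷ []) → refl }

run-reaches : ∀ {c d k} s → run s k ≡ c → c ↠ d → ∃ λ t → run t k ≡ d
run-reaches s e done        = s , e
run-reaches s e (refl ◅ r) = run-reaches (suc s) (cong step e) r

run-halted : ∀ {k s} d → fst (run s k) ≡ 0 → run (d + s) k ≡ run s k
run-halted         zero    e = refl
run-halted {k} {s} (suc d) e with run (d + s) k | run-halted {k} {s} d e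
... | _ | refl rewrite e = refl

run-deterministic : ∀ {k s t} → fst (run s k) ≡ 0 → fst (run t k) ≡ 0 → run s k ≡ run t k
run-deterministic {k} {s} {t} hs ht = trans (sym (run-halted {k} {s} t hs))
  (trans (cong (λ u → run u k) (+-comm t s)) (run-halted {k} {t} s ht))

run-converges : ∀ {k} {f : μRec k} {xs z} → f [ xs ]⇓ z → ∃ λ s → run s (pair ⌜ f ⌝ ⟨ xs ⟩) ≡ pair 0 z
run-converges {f = f} {xs} H = run-reaches 0
  (cong₂ (λ a b → pair (push a 0) b) (fst-pair ⌜ f ⌝ ⟨ xs ⟩) (snd-pair ⌜ f ⌝ ⟨ xs ⟩)) (complete H 0)

run-output : ∀ {k s t z} → run s k ≡ pair 0 z → fst (run t k) ≡ 0 → snd (run t k) ≡ z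
run-output {k} {s} {t} {z} e h = trans
  (cong snd (trans (sym (run-deterministic {k} {s} {t} (trans (cong fst e) (fst-pair 0 z)) h)) e)) (snd-pair 0 z)

-- The machine sees only the code, so equal codes have the same run. This stands in for injectivity
-- of `⌜_⌝`.
code-determines : ∀ {k} {f g : μRec k} {xs y z} → ⌜ f ⌝ ≡ ⌜ g ⌝ → f [ xs ]⇓ y → g [ xs ]⇓ z → y ≡ z
code-determines {f = f} {g} {xs} {y} {z} f≡g Hf Hg =
  let s , es = run-converges Hf
      t , et = run-converges Hg
      et′ = subst (λ c → run t (pair c ⟨ xs ⟩) ≡ pair 0 z) (sym f≡g) et
  in trans (sym (snd-pair 0 y)) (trans (cong snd (sym es))
       (run-output {pair ⌜ f ⌝ ⟨ xs ⟩} {t} {s} et′ (trans (cong fst es) (fst-pair 0 y))))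

opaque

  -- Requiring the output to be at most s makes the stage bound the output.
  HaltsBy : ℕ → ℕ → Set
  HaltsBy k s = fst (run s k) ≡ 0 × snd (run s k) ≤ s

  private
    haltsBy₂ : Fm 2
    haltsBy₂ = fstᶠ r ≡ᶠ lit 0 ∧ᶠ sndᶠ r ≤ᶠ var 1F
      where
      r : Fun 2
      r = runF ⟪ var 1F ∷ var 0F ∷ [] ⟫

  haltsBy-char : Fun 2
  haltsBy-char = char haltsBy₂

  haltsBy-decide : ∀ k s → Tests (HaltsBy k s) (fun haltsBy-char (k ∷ s ∷ []))
  haltsBy-decide k s = decide haltsBy₂ (k ∷ s ∷ [])

  halts : ∀ {k} {f : μRec k} {xs z} → f [ xs ]⇓ z →
    let key = pair ⌜ f ⌝ ⟨ xs ⟩ in (∃ λ s → HaltsBy key s) × (∀ s → HaltsBy key s → z ≤ s)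
  halts {f = f} {xs} {z} H =
    let s , e = run-converges H
        -- Waiting `z` more steps leaves the halted configuration unchanged and makes the stage at
        -- least the output.
        e′ = trans (run-halted {key} {s} z (trans (cong fst e) (fst-pair 0 z))) e
    in (z + s , trans (cong fst e′) (fst-pair 0 z) , ≤-trans (≤-reflexive (trans (cong snd e′) (snd-pair 0 z))) (m≤m+n z s))
       , λ t (h , le) → ≤-trans (≤-reflexive (sym (run-output {key} {s} {t} e h))) le
    where
    key : ℕ
    key = pair ⌜ f ⌝ ⟨ xs ⟩

haltsBy : ∀ {k} → Fun k → Fun k → Fm k
haltsBy f g = substᶠ (mkFm (λ { (k ∷ s ∷ []) → HaltsBy k s }) haltsBy-char
  λ { (k ∷ s ∷ []) → haltsBy-decide k s }) (f ∷ g ∷ [])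

Least : (ℕ → Set) → ℕ → Set
Least P n = P n × ∀ m → m < n → ¬ P m

least : ∀ {P : ℕ → Set} → (∀ n → Dec (P n)) → ∀ {n} → P n → ∃ λ m → m ≤ n × Least P m
least {P} P? {n} p = search n 0 (+-identityʳ n) λ _ ()
  where
  search : ∀ d c → d + c ≡ n → (∀ m → m < c → ¬ P m) → ∃ λ m → m ≤ n × Least P m
  search d c eq none with P? c
  ... | yes pc = c , subst (c ≤_) eq (m≤n+m c d) , pc , none
  search zero c refl none | no ¬pc = ⊥-elim (¬pc p)
  search (suc d) c eq none | no ¬pc = search d (suc c) (trans (+-suc d c) eq) (below-suc none ¬pc)

-- The order 𝓛

-- The stage `pair k 0` of the unconditional event is itself a code of the rational `k`; this event
-- makes 𝓛 unbounded. The other event is the first stage of halting, so a key has at most two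
-- events.
Event : ℕ → ℕ → Set
Event k s = s ≡ pair k 0 ⊎ HaltsBy k s × (∀ i → i < s → ¬ HaltsBy k i)

eventᶠ : ∀ {k} → Fun k → Fun k → Fm k
eventᶠ f g = substᶠ (s ≡ᶠ pairᶠ k (lit 0) ∨ᶠ haltsBy k s ∧ᶠ all< s (¬ᶠ haltsBy (var 1F) (var 0F))) (f ∷ g ∷ [])
  where
  k s : Fun 2
  k = var 0F
  s = var 1F

num den : ℕ → ℕ
num j = fst j
den j = suc (snd j)

numᶠ denᶠ : ∀ {k} → Fun k → Fun k
numᶠ f = fstᶠ f
denᶠ f = sucᶠ (sndᶠ f)

infix 4 _⊑_ _⊏_ _≼_

-- Comparison of fractions by cross-multiplication; in `≼` the left side is an integer.
_⊑_ _⊏_ _≼_ : ℕ → ℕ → Set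
i ⊑ j = num i * den j ≤ num j * den i
i ⊏ j = num i * den j < num j * den i
k ≼ j = k * den j ≤ num j

-- The explicit bound on `k` makes the quantifier bounded, hence the predicate computable.
Active : ℕ → ℕ → Set
Active j s = ∃ λ k → k < suc (num j) × k ≼ j × Event k s

-- Each rational is represented by its least code.
Canonical : ℕ → Set
Canonical j = ∀ i → i < j → ¬ (i ⊑ j × j ⊑ i)

-- A rational waits for the stage of its own code, so that a bound on the stages of entry bounds the
-- codes as well.
Enters : ℕ → ℕ → Set
Enters j s = j ≤ s × Active j s × ∀ i → i < s → j ≤ i → ¬ Active j i

⊑ᶠ ⊏ᶠ ≼ᶠ activeᶠ entersᶠ : ∀ {k} → Fun k → Fun k → Fm k
⊑ᶠ f g = numᶠ f *ᶠ denᶠ g ≤ᶠ numᶠ g *ᶠ denᶠ f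
⊏ᶠ f g = numᶠ f *ᶠ denᶠ g <ᶠ numᶠ g *ᶠ denᶠ f
≼ᶠ f g = f *ᶠ denᶠ g ≤ᶠ numᶠ g
activeᶠ f g = substᶠ (ex< (sucᶠ (numᶠ (var 0F))) (≼ᶠ (var 0F) (var 1F) ∧ᶠ eventᶠ (var 0F) (var 2F))) (f ∷ g ∷ [])

canonicalᶠ : ∀ {k} → Fun k → Fm k
canonicalᶠ f = substᶠ (all< (var 0F) (¬ᶠ (⊑ᶠ (var 0F) (var 1F) ∧ᶠ ⊑ᶠ (var 1F) (var 0F)))) (f ∷ [])
entersᶠ f g = substᶠ (var 0F ≤ᶠ var 1F ∧ᶠ activeᶠ (var 0F) (var 1F) ∧ᶠ
  all< (var 1F) (var 1F ≤ᶠ var 0F →ᶠ ¬ᶠ activeᶠ (var 1F) (var 0F))) (f ∷ g ∷ [])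
active? : ∀ j s → Dec (Active j s)
active? j s = truth? (activeᶠ (var 0F) (var 1F)) (j ∷ s ∷ [])

⊑-trans : ∀ {i j l} → i ⊑ j → j ⊑ l → i ⊑ l
⊑-trans {i} {j} {l} p q = *-cancelʳ-≤ _ _ (den j) (begin
  num i * den l * den j ≡⟨ xy∙z≈xz∙y (num i) (den l) (den j) ⟩
  num i * den j * den l ≤⟨ *-monoˡ-≤ (den l) p ⟩
  num j * den i * den l ≡⟨ xy∙z≈xz∙y (num j) (den i) (den l) ⟩
  num j * den l * den i ≤⟨ *-monoˡ-≤ (den i) q ⟩
  num l * den j * den i ≡⟨ xy∙z≈xz∙y (num l) (den j) (den i) ⟩
  num l * den i * den j ∎)
  where open ≤-Reasoning

≼-⊑ : ∀ {k i j} → k ≼ i → i ⊑ j → k ≼ j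
≼-⊑ {k} {i} {j} p q = *-cancelʳ-≤ _ _ (den i) (begin
  k * den j * den i     ≡⟨ xy∙z≈xz∙y k (den j) (den i) ⟩
  k * den i * den j ≤⟨ *-monoˡ-≤ (den j) p ⟩
  num i * den j ≤⟨ q ⟩
  num j * den i ∎)
  where open ≤-Reasoning

⊏-⊑ : ∀ {i j l} → i ⊏ j → j ⊑ l → i ⊏ l
⊏-⊑ {i} {j} {l} p q = ≰⇒> λ r → <⇒≱ p (⊑-trans {j} {l} {i} q r)

⊑-⊏ : ∀ {i j l} → i ⊑ j → j ⊏ l → i ⊏ l
⊑-⊏ {i} {j} {l} p q = ≰⇒> λ r → <⇒≱ q (⊑-trans {l} {i} {j} r p)

≼⇒≤ : ∀ {k j} → k ≼ j → k ≤ num j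
≼⇒≤ {k} {j} p = ≤-trans (m≤m*n k (den j)) p

canonical : ∀ j → ∃ λ i → i ≤ j × Canonical i × i ⊑ j × j ⊑ i
canonical j with least (λ i → truth? (⊑ᶠ (var 0F) (var 1F) ∧ᶠ ⊑ᶠ (var 1F) (var 0F)) (i ∷ j ∷ []))
                     {j} (≤-refl , ≤-refl)
... | i , i≤j , (p , q) , none = i , i≤j ,
  (λ l l<i → λ { (r , s) → none l l<i (⊑-trans {l} {i} {j} r p , ⊑-trans {j} {i} {l} q s) }) , p , q

-- Since `den` adds one, `snd i + den j` encodes the denominator `den i + den j`.
mediant : ℕ → ℕ → ℕ
mediant i j = pair (num i + num j) (snd i + den j)

mediantᶠ : ∀ {k} → Fun k → Fun k → Fun k
mediantᶠ f g = pairᶠ (numᶠ f +ᶠ numᶠ g) (sndᶠ f +ᶠ denᶠ g)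

mediant-between : ∀ i j → i ⊏ j → i ⊏ mediant i j × mediant i j ⊏ j
mediant-between i j p
  rewrite fst-pair (num i + num j) (snd i + den j) | snd-pair (num i + num j) (snd i + den j) =
  (begin-strict
    num i * (den i + den j)         ≡⟨ *-distribˡ-+ (num i) (den i) (den j) ⟩
    num i * den i + num i * den j   <⟨ +-monoʳ-< (num i * den i) p ⟩
    num i * den i + num j * den i   ≡⟨ *-distribʳ-+ (den i) (num i) (num j) ⟨
    (num i + num j) * den i         ∎) ,
  (begin-strict
    (num i + num j) * den j         ≡⟨ *-distribʳ-+ (den j) (num i) (num j) ⟩
    num i * den j + num j * den j   <⟨ +-monoˡ-< (num j * den j) p ⟩
    num j * den i + num j * den j   ≡⟨ *-distribˡ-+ (num j) (den i) (den j) ⟨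
    num j * (den i + den j)         ∎)
  where open ≤-Reasoning

opaque

  -- An element carries its stage of entry. This makes membership decidable, whereas asking whether
  -- a rational ever enters is a search through all stages. The equation excludes numbers that are
  -- no pairs.
  InL : ℕ → Set
  InL x = x ≡ pair (fst x) (snd x) × Canonical (fst x) × Enters (fst x) (snd x)

  _≺_ : ℕ → ℕ → Set
  x ≺ y = InL x × InL y × fst x ⊏ fst y

  ≺-dom : ∀ {x y} → x ≺ y → InL x × InL y
  ≺-dom (lx , ly , _) = lx , ly

  ≼-≺ : ∀ {k x y} → k ≼ fst x → x ≺ y → k ≼ fst y
  ≼-≺ {k} {x} {y} p (_ , _ , q) = ≼-⊑ {k} {fst x} {fst y} p (<⇒≤ q)

  private
    inL₁ : Fm 1
    inL₁ = x ≡ᶠ pairᶠ (fstᶠ x) (sndᶠ x) ∧ᶠ canonicalᶠ (fstᶠ x) ∧ᶠ entersᶠ (fstᶠ x) (sndᶠ x)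
      where
      x : Fun 1
      x = var 0F

  inL-char : Fun 1
  inL-char = char inL₁

  inL-decide : ∀ x → Tests (InL x) (fun inL-char (x ∷ []))
  inL-decide x = decide inL₁ (x ∷ [])

  -- The rational determines its canonical code, and the code determines the first stage of entry.
  InL-unique : ∀ {x y} → InL x → InL y → fst x ⊑ fst y → fst y ⊑ fst x → x ≡ y
  InL-unique {x} {y} (x≡ , cx , j≤s , act , first) (y≡ , cy , j≤s′ , act′ , first′) p q =
    trans x≡ (trans (cong₂ pair j≡ s≡) (sym y≡))
    where
    j≡ : fst x ≡ fst y
    j≡ with <-cmp (fst x) (fst y)
    ... | tri< lt _ _ = ⊥-elim (cy _ lt (p , q))
    ... | tri≈ _ e _  = e
    ... | tri> _ _ gt = ⊥-elim (cx _ gt (q , p))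
    s≡ : snd x ≡ snd y
    s≡ with <-cmp (snd x) (snd y)
    ... | tri< lt _ _ = ⊥-elim (first′ _ lt (subst (_≤ snd x) j≡ j≤s) (subst (λ j → Active j (snd x)) j≡ act))
    ... | tri≈ _ e _  = e
    ... | tri> _ _ gt = ⊥-elim (first _ gt (subst (_≤ snd y) (sym j≡) j≤s′) (subst (λ j → Active j (snd y)) (sym j≡) act′))

  ≺-irrefl : ∀ {x} → ¬ x ≺ x
  ≺-irrefl (_ , _ , p) = <-irrefl refl p

  ≺-trans : ∀ {x y z} → x ≺ y → y ≺ z → x ≺ z
  ≺-trans {x} {y} {z} (lx , _ , p) (_ , lz , q) = lx , lz , ⊏-⊑ {fst x} {fst y} {fst z} p (<⇒≤ q)

  ≺-connex : ∀ {x y} → InL x → InL y → x ≺ y ⊎ x ≡ y ⊎ y ≺ x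
  ≺-connex {x} {y} lx ly with <-cmp (num (fst x) * den (fst y)) (num (fst y) * den (fst x))
  ... | tri< lt _ _ = inj₁ (lx , ly , lt)
  ... | tri≈ _ e _  = inj₂ (inj₁ (InL-unique lx ly (≤-reflexive e) (≤-reflexive (sym e))))
  ... | tri> _ _ gt = inj₂ (inj₂ (ly , lx , gt))

  enter : ∀ {j s} → Canonical j → j ≤ s → Active j s → ∃ λ x → InL x × fst x ≡ j
  enter {j} {s} c j≤s a = go (least {λ i → j ≤ i × Active j i} (λ i → (j ≤? i) ×-dec active? j i) (j≤s , a))
    where
    go : (∃ λ e → e ≤ s × Least (λ i → j ≤ i × Active j i) e) → ∃ λ x → InL x × fst x ≡ j
    go (e , _ , (j≤e , act) , first) = pair j e ,
      (sym (cong₂ pair (fst-pair j e) (snd-pair j e)) ,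
       subst Canonical (sym (fst-pair j e)) c ,
       subst₂ Enters (sym (fst-pair j e)) (sym (snd-pair j e))
         (j≤e , act , λ i i<e j≤i act′ → first i i<e (j≤i , act′))) ,
      fst-pair j e

  -- The unconditional event of `k` lets in the rational `k`: its canonical code is at most
  -- `pair k 0`, the stage of that event.
  L-unbounded : ∀ k → ∃ λ x → InL x × k ≤ x × k ≼ fst x
  L-unbounded k =
    let j , j≤ , can , _ , le = canonical (pair k 0)
        k≼j = ≼-⊑ {k} {pair k 0} {j} k≼ le
        x , lx , x≡ = enter can j≤ (k , s≤s (≼⇒≤ {k} {j} k≼j) , k≼j , inj₁ refl)
    in x , lx , ≤-trans (≼⇒≤ {k} {j} k≼j) (≤-trans (fst≤ j) (subst (_≤ x) x≡ (fst≤ x))) , subst (k ≼_) (sym x≡) k≼j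
    where
    k≼ : k ≼ pair k 0
    k≼ = ≤-reflexive (trans (cong (λ n → k * suc n) (snd-pair k 0))
      (trans (*-identityʳ k) (sym (fst-pair k 0))))

  -- An event of a later stage would make the canonical code of the mediant
  -- enter the order between a and b.
  adjacent⇒settled : ∀ {a b} → a ≺ b → (∀ c → ¬ (a ≺ c × c ≺ b)) →
    ∀ {k s} → k ≼ fst a → Event k s → s < mediant (fst a) (fst b)
  adjacent⇒settled {a} {b} (la , lb , p) none {k} {s} k≼a ev = ≰⇒> not-later
    where
    i j m : ℕ
    i = fst a
    j = fst b
    m = mediant i j
    not-later : ¬ m ≤ s
    not-later m≤s =
      let c , c≤m , can , c⊑m , m⊑c = canonical m
          i⊏m , m⊏j = mediant-between i j p
          i⊏c = ⊏-⊑ {i} {m} {c} i⊏m m⊑c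
          c⊏j = ⊑-⊏ {c} {m} {j} c⊑m m⊏j
          k≼c = ≼-⊑ {k} {i} {c} k≼a (<⇒≤ i⊏c)
          x , lx , x≡ = enter can (≤-trans c≤m m≤s) (k , s≤s (≼⇒≤ {k} {c} k≼c) , k≼c , ev)
      in none x ((la , lx , subst (i ⊏_) (sym x≡) i⊏c) , lx , lb , subst (_⊏ j) (sym x≡) c⊏j)

inLᶠ : ∀ {k} → Fun k → Fm k
inLᶠ f = substᶠ (mkFm (λ { (x ∷ []) → InL x }) inL-char λ { (x ∷ []) → inL-decide x }) (f ∷ [])

opaque

  unfolding _≺_

  private
    ≺₂ : Fm 2
    ≺₂ = inLᶠ (var 0F) ∧ᶠ inLᶠ (var 1F) ∧ᶠ ⊏ᶠ (fstᶠ (var 0F)) (fstᶠ (var 1F))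

  ≺-char : Fun 2
  ≺-char = char ≺₂

  ≺-decide : ∀ x y → Tests (x ≺ y) (fun ≺-char (x ∷ y ∷ []))
  ≺-decide x y = decide ≺₂ (x ∷ y ∷ [])

≺ᶠ : ∀ {k} → Fun k → Fun k → Fm k
≺ᶠ f g = substᶠ (mkFm (λ { (x ∷ y ∷ []) → x ≺ y }) ≺-char λ { (x ∷ y ∷ []) → ≺-decide x y }) (f ∷ g ∷ [])

L-computable : Computable (unary InL)
L-computable = Fm-computable (restate (inLᶠ (var 0F)) (unary InL) (λ _ p → p) λ _ p → p)

≺-computable : Computable (binary _≺_)
≺-computable = Fm-computable (restate (≺ᶠ (var 0F) (var 1F)) (binary _≺_) (λ _ p → p) λ _ p → p)

≺-isStrictTotalOrder : IsStrictTotalOrder {A = Σ ℕ InL} (_≡_ on proj₁) (_≺_ on proj₁)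
≺-isStrictTotalOrder = record
  { isStrictPartialOrder = record
    { isEquivalence = record { refl = refl ; sym = sym ; trans = trans }
    ; irrefl = λ { refl → ≺-irrefl }
    ; trans = ≺-trans
    ; <-resp-≈ = (λ { refl p → p }) , λ { refl p → p }
    }
  ; compare = compare
  }
  where
  compare : Trichotomous {A = Σ ℕ InL} (_≡_ on proj₁) (_≺_ on proj₁)
  compare (x , lx) (y , ly) with ≺-connex lx ly
  ... | inj₁ p           = tri< p (λ { refl → ≺-irrefl p }) (λ q → ≺-irrefl (≺-trans p q))
  ... | inj₂ (inj₁ refl) = tri≈ ≺-irrefl refl ≺-irrefl
  ... | inj₂ (inj₂ q)    = tri> (λ p → ≺-irrefl (≺-trans p q)) (λ { refl → ≺-irrefl q }) q

halting-event : ∀ {k} {f : μRec k} {xs z} → f [ xs ]⇓ z →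
  ∃ λ s → Event (pair ⌜ f ⌝ ⟨ xs ⟩) s × z ≤ s
halting-event {f = f} {xs} H =
  let (t , h) , bound = halts H
      s , _ , first = least (λ s → truth? (haltsBy (var 1F) (var 0F)) (s ∷ pair ⌜ f ⌝ ⟨ xs ⟩ ∷ [])) h
  in s , inj₂ first , bound s (proj₁ first)

-- Each element has finitely many predecessors

module _ (em : ExcludedMiddle 0ℓ) where

  -- Each key has at most two events; excluded middle decides whether the second one occurs.
  events-bounded : ∀ K → ∃ λ B → ∀ k → k ≤ K → ∀ s → Event k s → s ≤ B
  events-bounded K = let B , b = go (suc K) in B , λ k k≤K → b k (s≤s k≤K)
    where
    one : ∀ k → ∃ λ B → ∀ s → Event k s → s ≤ B
    one k with em {∃ λ s → HaltsBy k s}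
    ... | yes (t , h) = pair k 0 ⊔ t , λ
      { s (inj₁ e) → ≤-trans (≤-reflexive e) (m≤m⊔n _ t)
      ; s (inj₂ (_ , first)) → ≤-trans (≮⇒≥ λ t<s → first t t<s h) (m≤n⊔m _ t) }
    ... | no ¬h = pair k 0 , λ
      { s (inj₁ e) → ≤-reflexive e
      ; s (inj₂ (h , _)) → ⊥-elim (¬h (s , h)) }
    go : ∀ K → ∃ λ B → ∀ k → k < K → ∀ s → Event k s → s ≤ B
    go zero = 0 , λ _ ()
    go (suc K) with go K | one K
    ... | B , b | B′ , b′ = B ⊔ B′ , below-suc
      (λ k k<K s ev → ≤-trans (b k k<K s ev) (m≤m⊔n B B′)) λ s ev → ≤-trans (b′ s ev) (m≤n⊔m B B′)

  opaque

    unfolding _≺_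

    -- The event that let `y` in has a key at most the value of `y`, hence of `x`. Such events have
    -- bounded stages, which bounds the stage of `y` and, through `j ≤ s`, its code.
    predecessors-bounded : ∀ x → ∃ λ B → ∀ y → y ≺ x → y ≤ B
    predecessors-bounded x with events-bounded (num (fst x))
    ... | B , b = pair B B , λ { y ((y≡ , _ , j≤s , (k , _ , k≼ , ev) , _) , _ , p) →
      let s≤B = b k (≼⇒≤ {k} {fst x} (≼-⊑ {k} {fst y} {fst x} k≼ (<⇒≤ p))) (snd y) ev
      in ≤-trans (≤-reflexive y≡) (pair-mono-≤ (≤-trans j≤s s≤B) s≤B) }

𝓛 : ComputableLinearOrder
𝓛 = record
  { L                  = InL
  ; _≺_                = _≺_
  ; L-nonempty         = let x , lx , _ = L-unbounded 0 in x , lx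
  ; L-computable       = L-computable
  ; ≺-on-L             = ≺-dom
  ; ≺-computable       = ≺-computable
  ; isStrictTotalOrder = ≺-isStrictTotalOrder
  }

-- Determinism and search programs

mutual
  deterministic : ∀ {k} {f : μRec k} {xs y z} → f [ xs ]⇓ y → f [ xs ]⇓ z → y ≡ z
  deterministic zero          zero            = refl
  deterministic suc           suc             = refl
  deterministic (proj i)      (proj _)        = refl
  deterministic (comp Hs H)   (comp Hs′ H′)   with deterministic* Hs Hs′
  ... | refl = deterministic H H′
  deterministic (prec₀ H)     (prec₀ H′)      = deterministic H H′
  deterministic (precₛ Hr H)  (precₛ Hr′ H′)  with deterministic Hr Hr′
  ... | refl = deterministic H H′
  deterministic (μ {n = n} below H) (μ {n = n′} below′ H′) with <-cmp n n′
  ... | tri≈ _ e _   = e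
  ... | tri< n<n′ _ _ with below′ n n<n′
  ...   | y , Hy with deterministic H Hy
  ...     | ()
  deterministic (μ {n = n} below H) (μ {n = n′} below′ H′) | tri> _ _ n′<n with below n′ n′<n
  ...   | y , Hy with deterministic Hy H′
  ...     | ()

  deterministic* : ∀ {k m} {gs : Vec (μRec k) m} {xs ys zs} → gs [ xs ]⇓* ys → gs [ xs ]⇓* zs → ys ≡ zs
  deterministic* []       []         = refl
  deterministic* (H ∷ Hs) (H′ ∷ Hs′) = cong₂ _∷_ (deterministic H H′) (deterministic* Hs Hs′)

-- θ speaks about x ∷ n ∷ φ n ∷ ψ n ∷ [], and the search is for the least x.
search : Fm 4 → μRec 1 → μRec 1 → μRec 1
search θ φ ψ = comp (μ (prog (lit 1 ∸ᶠ char θ))) (proj 0F ∷ φ ∷ ψ ∷ [])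

search-intro : ∀ (θ : Fm 4) {φ ψ n l m x} → φ ⟨ n ⟩↓= l → ψ ⟨ n ⟩↓= m → truth θ (x ∷ n ∷ l ∷ m ∷ []) →
  n ∈ dom (search θ φ ψ)
search-intro θ {n = n} {l} {m} hφ hψ t =
  let y , _ , ty , first = least (λ x → truth? θ (x ∷ n ∷ l ∷ m ∷ [])) t
  in y , comp (proj 0F ∷ hφ ∷ hψ ∷ []) (μ (λ i i<y → 0 , refute i (first i i<y)) (confirm y ty))
  where
  test : ℕ → Set
  test x = truth θ (x ∷ n ∷ l ∷ m ∷ [])
  program : μRec 4
  program = prog (lit 1 ∸ᶠ char θ)
  converges : ∀ x → program [ x ∷ n ∷ l ∷ m ∷ [] ]⇓ (1 ∸ fun (char θ) (x ∷ n ∷ l ∷ m ∷ []))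
  converges x = correct (lit 1 ∸ᶠ char θ) (x ∷ n ∷ l ∷ m ∷ [])
  value : ∀ {x c} → fun (char θ) (x ∷ n ∷ l ∷ m ∷ []) ≡ c → program [ x ∷ n ∷ l ∷ m ∷ [] ]⇓ (1 ∸ c)
  value {x} refl = converges x
  refute : ∀ x → ¬ test x → program [ x ∷ n ∷ l ∷ m ∷ [] ]⇓ 1
  refute x ¬t with decide θ (x ∷ n ∷ l ∷ m ∷ [])
  ... | inj₁ (t , _) = ⊥-elim (¬t t)
  ... | inj₂ (_ , e) = value e
  confirm : ∀ x → test x → program [ x ∷ n ∷ l ∷ m ∷ [] ]⇓ 0
  confirm x t with decide θ (x ∷ n ∷ l ∷ m ∷ [])
  ... | inj₁ (_ , e)  = value e
  ... | inj₂ (¬t , _) = ⊥-elim (¬t t)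

search-elim : ∀ (θ : Fm 4) {φ ψ n x} → search θ φ ψ ⟨ n ⟩↓= x →
  ∃ λ l → ∃ λ m → φ ⟨ n ⟩↓= l × ψ ⟨ n ⟩↓= m × truth θ (x ∷ n ∷ l ∷ m ∷ [])
search-elim θ {n = n} {x} (comp (_∷_ {y = _} (proj _) (_∷_ {y = l} hφ (_∷_ {y = m} hψ []))) (μ _ H)) = l , m , hφ , hψ , holds
  where
  holds : truth θ (x ∷ n ∷ l ∷ m ∷ [])
  holds with decide θ (x ∷ n ∷ l ∷ m ∷ [])
  ... | inj₁ (t , _) = t
  ... | inj₂ (_ , e) with trans (deterministic H (correct (lit 1 ∸ᶠ char θ) (x ∷ n ∷ l ∷ m ∷ []))) (cong (1 ∸_) e)
  ...   | ()

-- The increasing enumeration of 𝓛 by ω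

module _ (em : ExcludedMiddle 0ℓ) where

  -- The predecessors of one given element are numerically bounded, so going through finitely many
  -- numbers suffices.
  ≺-minimum : ∀ {P : ℕ → Set} → (∀ {x} → P x → InL x) → ∃ P → ∃ λ m → P m × ∀ y → P y → ¬ y ≺ m
  ≺-minimum {P} P⊆L (x , px) =
    let B , bound = predecessors-bounded em x
    -- The range covers `x` and all its predecessors; whatever lies below a minimum of the range
    -- also lies below `x`, hence in the range.
    in finish B bound (below (suc (B ⊔ x)))
    where
    below : ∀ N → (∀ y → y < N → ¬ P y) ⊎ (∃ λ m → P m × ∀ y → y < N → P y → ¬ y ≺ m)
    below zero = inj₁ λ _ ()
    below (suc N) with below N | em {P N}
    ... | inj₁ none           | no ¬p = inj₁ (below-suc none ¬p)
    ... | inj₁ none           | yes p = inj₂ (N , p , below-suc (λ y y<N py → ⊥-elim (none y y<N py)) λ _ → ≺-irrefl)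
    ... | inj₂ (m , pm , min) | no ¬p = inj₂ (m , pm , below-suc min λ p → ⊥-elim (¬p p))
    ... | inj₂ (m , pm , min) | yes p with ≺-connex (P⊆L pm) (P⊆L p)
    ...   | inj₁ m≺N         = inj₂ (m , pm , below-suc min λ _ N≺m → ≺-irrefl (≺-trans m≺N N≺m))
    ...   | inj₂ (inj₁ refl) = inj₂ (m , pm , below-suc min λ _ → ≺-irrefl)
    ...   | inj₂ (inj₂ N≺m)  = inj₂ (N , p , below-suc (λ y y<N py y≺N → min y y<N py (≺-trans y≺N N≺m)) λ _ → ≺-irrefl)
    finish : ∀ B → (∀ y → y ≺ x → y ≤ B) →
      (∀ y → y < suc (B ⊔ x) → ¬ P y) ⊎ (∃ λ m → P m × ∀ y → y < suc (B ⊔ x) → P y → ¬ y ≺ m) →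
      ∃ λ m → P m × ∀ y → P y → ¬ y ≺ m
    finish B bound (inj₁ none) = ⊥-elim (none x (s≤s (m≤n⊔m B x)) px)
    finish B bound (inj₂ (m , pm , min)) = m , pm , λ y py y≺m →
      min y (s≤s (≤-trans (bound y (y≺x y≺m)) (m≤m⊔n B x))) py y≺m
      where
      y≺x : ∀ {y} → y ≺ m → y ≺ x
      y≺x y≺m with ≺-connex (P⊆L pm) (P⊆L px)
      ... | inj₁ m≺x         = ≺-trans y≺m m≺x
      ... | inj₂ (inj₁ refl) = y≺m
      ... | inj₂ (inj₂ x≺m)  = ⊥-elim (min x (s≤s (m≤n⊔m B x)) px x≺m)

  opaque

    eventually-above : ∀ {x} → InL x → ∃ λ N → ∀ y → InL y → N ≤ y → x ≺ y
    eventually-above {x} lx with predecessors-bounded em x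
    ... | B , bound = suc (B ⊔ x) , above
      where
      above : ∀ y → InL y → suc (B ⊔ x) ≤ y → x ≺ y
      above y ly N≤y with ≺-connex lx ly
      ... | inj₁ x≺y         = x≺y
      ... | inj₂ (inj₁ refl) = ⊥-elim (<-irrefl refl (≤-trans (s≤s (m≤n⊔m B x)) N≤y))
      ... | inj₂ (inj₂ y≺x)  = ⊥-elim (<-irrefl refl (≤-trans (s≤s (≤-trans (bound y y≺x) (m≤m⊔n B x))) N≤y))

  successor : ∀ {x} → InL x → ∃ λ y → x ≺ y × ∀ z → x ≺ z → ¬ z ≺ y
  successor lx =
    let N , above = eventually-above lx
        y , ly , N≤y , _ = L-unbounded N
    in ≺-minimum (proj₂ ∘ ≺-dom) (y , above y ly N≤y)

  opaque

    element : ℕ → Σ ℕ InL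
    element zero    =
      let x , lx , _ = L-unbounded 0
          y , ly , _ = ≺-minimum id (x , lx)
      in y , ly
    element (suc k) = let y , x≺y , _ = successor (proj₂ (element k)) in y , proj₂ (≺-dom x≺y)

    e : ℕ → ℕ
    e k = proj₁ (element k)

    e∈L : ∀ k → InL (e k)
    e∈L k = proj₂ (element k)

    e-step : ∀ k → e k ≺ e (suc k)
    e-step k = proj₁ (proj₂ (successor (e∈L k)))

    no-element-below-e₀ : ∀ {x} → ¬ x ≺ e 0
    no-element-below-e₀ {x} p =
      proj₂ (proj₂ (≺-minimum id (let x , lx , _ = L-unbounded 0 in x , lx)))
        x (proj₁ (≺-dom p)) p

    e-adjacent : ∀ {k x} → e k ≺ x → ¬ x ≺ e (suc k)
    e-adjacent {k} {x} = proj₂ (proj₂ (successor (e∈L k))) x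

  e-mono : ∀ {k l} → k < l → e k ≺ e l
  e-mono {k} {suc l} (s≤s k≤l) with m≤n⇒m<n∨m≡n k≤l
  ... | inj₁ k<l  = ≺-trans (e-mono k<l) (e-step l)
  ... | inj₂ refl = e-step k

  -- A missed element would, by induction, lie above every `e k`. As its predecessors are bounded,
  -- the pigeonhole principle would make `e` repeat a value.
  e-onto : ∀ {x} → InL x → ∃ λ k → e k ≡ x
  e-onto {x} lx with em {∃ λ k → e k ≡ x}
  ... | yes w = w
  ... | no missed = ⊥-elim (
    let B , bound = predecessors-bounded em x
        i , j , i<j , fi≡fj = Fin.pigeonhole (n<1+n (suc B)) λ i → fromℕ< (s≤s (bound (e (toℕ i)) (all-below (toℕ i))))
    in collide i<j (Fin.fromℕ<-injective _ _ _ _ fi≡fj))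
    where
    all-below : ∀ k → e k ≺ x
    all-below k with ≺-connex (e∈L k) lx
    ... | inj₁ p        = p
    ... | inj₂ (inj₁ q) = ⊥-elim (missed (k , q))
    all-below zero    | inj₂ (inj₂ p) = ⊥-elim (no-element-below-e₀ p)
    all-below (suc k) | inj₂ (inj₂ p) = ⊥-elim (e-adjacent {k} (all-below k) p)
    collide : ∀ {k l} → k < l → e k ≡ e l → ⊥
    collide {l = l} k<l eq = ≺-irrefl (subst (_≺ e l) eq (e-mono k<l))

  e-cancel : ∀ {k l} → e k ≺ e l → k < l
  e-cancel {k} {l} p with <-cmp k l
  ... | tri< k<l _ _  = k<l
  ... | tri≈ _ refl _ = ⊥-elim (≺-irrefl p)
  ... | tri> _ _ l<k  = ⊥-elim (≺-irrefl (≺-trans p (e-mono l<k)))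

  e-injective : ∀ {k l} → e k ≡ e l → k ≡ l
  e-injective {k} {l} p with <-cmp k l
  ... | tri< k<l _ _ = ⊥-elim (≺-irrefl (subst (_≺ e l) p (e-mono {k} {l} k<l)))
  ... | tri≈ _ q _   = q
  ... | tri> _ _ l<k = ⊥-elim (≺-irrefl (subst (e l ≺_) p (e-mono {l} {k} l<k)))

  𝓛-copy : IsCopyOfω 𝓛
  𝓛-copy = rank , record
    { isOrderMonomorphism = record
      { isOrderHomomorphism = record
        { cong = λ { {x , lx} {_ , ly} refl → e-injective (trans (e-rank (x , lx)) (sym (e-rank (x , ly)))) }
        ; mono = λ {x} {y} p → e-cancel (subst₂ _≺_ (sym (e-rank x)) (sym (e-rank y)) p)
        }
      ; injective = λ {x} {y} p → trans (sym (e-rank x)) (trans (cong e p) (e-rank y))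
      ; cancel    = λ {x} {y} p → subst₂ _≺_ (e-rank x) (e-rank y) (e-mono p)
      }
    ; surjective = λ k → (e k , e∈L k) , λ {x} p → e-injective (trans (e-rank x) p)
    }
    where
    rank : Σ ℕ InL → ℕ
    rank (_ , lx) = proj₁ (e-onto lx)
    e-rank : ∀ x → e (rank x) ≡ proj₁ x
    e-rank (_ , lx) = proj₂ (e-onto lx)

-- The cohesive power

module AlmostAll (em : ExcludedMiddle 0ℓ) (C : Pred ℕ 0ℓ) where

  -- A bound on the exceptions replaces the list of them in `⊆*`, so that two such statements
  -- combine by taking a maximum.
  Almost : (ℕ → Set) → Set
  Almost Y = ∃ λ N → ∀ n → N ≤ n → C n → Y n

  ⊆*⇒Almost : ∀ {Y} → C ⊆* Y → Almost Y
  ⊆*⇒Almost {Y} (xs , to , _) = suc (max 0 xs) , above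
    where
    above : ∀ n → suc (max 0 xs) ≤ n → C n → Y n
    above n N≤n c with em {Y n}
    ... | yes y = y
    ... | no ¬y = ⊥-elim (<-irrefl refl (≤-trans N≤n (All.lookup (xs≤max 0 xs) (to (c , ¬y)))))

  Almost⇒⊆* : ∀ {Y} → Almost Y → C ⊆* Y
  Almost⇒⊆* {Y} (N , above) = filter exception? (upTo N) ,
    (λ {n} x → ∈-filter⁺ exception? (∈-upTo⁺ (≰⇒> λ N≤n → proj₂ x (above n N≤n (proj₁ x)))) x) ,
    λ x → proj₂ (∈-filter⁻ exception? {xs = upTo N} x)
    where
    exception? : ∀ n → Dec ((C ∖ Y) n)
    exception? n = em

  always : ∀ {Y : ℕ → Set} → (∀ n → Y n) → Almost Y
  always f = 0 , λ n _ _ → f n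

  almost-map : ∀ {Y Z : ℕ → Set} → (∀ n → Y n → Z n) → Almost Y → Almost Z
  almost-map f (N , a) = N , λ n N≤n c → f n (a n N≤n c)

  almost-map₂ : ∀ {Y Z W : ℕ → Set} → (∀ n → Y n → Z n → W n) → Almost Y → Almost Z → Almost W
  almost-map₂ f (N , a) (M , b) = N ⊔ M , λ n le c →
    f n (a n (≤-trans (m≤m⊔n N M) le) c) (b n (≤-trans (m≤n⊔m N M) le) c)

  eventually : ∀ {Y : ℕ → Set} N → (∀ n → N ≤ n → Y n) → Almost Y
  eventually N f = N , λ n N≤n _ → f n N≤n

module Power (em : ExcludedMiddle 0ℓ) (C : Pred ℕ 0ℓ) (coh : Cohesive C) where

  open AlmostAll em C public
  open Cohesive coh

  unbounded : ∀ N → ∃ λ n → N ≤ n × C n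
  unbounded N with em {∃ λ n → N ≤ n × C n}
  ... | yes w = w
  ... | no none with Almost⇒⊆* {λ _ → ⊥} (N , λ n N≤n c → none (n , N≤n , c))
  ...   | xs , to , from = ⊥-elim (infinite (xs , (λ c → to (c , λ ())) , λ x → proj₁ (from x)))

  witness : ∀ {Y : ℕ → Set} → Almost Y → ∃ Y
  witness (N , a) = let n , N≤n , c = unbounded N in n , a n N≤n c

  -- The form in which cohesiveness is applied: along `C` a program halts almost always or almost
  -- never.
  almost-or : ∀ φ → Almost (dom φ) ⊎ Almost (λ n → ¬ dom φ n)
  almost-or φ with cohesive (dom φ) (φ , id , id)
  ... | inj₁ a = inj₁ (⊆*⇒Almost a)
  ... | inj₂ a = inj₂ (⊆*⇒Almost a)

  𝔻 : Set
  𝔻 = D C 𝓛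

  open D

  infix 4 _↓_,_ _∼_ _◁_

  _↓_,_ : 𝔻 → ℕ → ℕ → Set
  p ↓ n , x = φ p ⟨ n ⟩↓= x

  total : ∀ p → Almost λ n → ∃ λ x → p ↓ n , x
  total p = ⊆*⇒Almost (defined p)

  _∼_ _◁_ : 𝔻 → 𝔻 → Set
  p ∼ q = Almost λ n → ∃ λ x → p ↓ n , x × q ↓ n , x
  p ◁ q = Almost λ n → ∃ λ x → ∃ λ y → p ↓ n , x × q ↓ n , y × x ≺ y

  ∼-refl : ∀ {p} → p ∼ p
  ∼-refl {p} = almost-map (λ { n (x , h) → x , h , h }) (total p)

  ∼-sym : ∀ {p q} → p ∼ q → q ∼ p
  ∼-sym = almost-map λ { n (x , h , h′) → x , h′ , h }

  ∼-trans : ∀ {p q r} → p ∼ q → q ∼ r → p ∼ r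
  ∼-trans {p} {q} {r} = almost-map₂ λ { n (x , hp , hq) (y , hq′ , hr) →
    x , hp , subst (r ↓ n ,_) (deterministic hq′ hq) hr }

  ◁-trans : ∀ {p q r} → p ◁ q → q ◁ r → p ◁ r
  ◁-trans = almost-map₂ λ { n (x , y , hp , hq , x≺y) (y′ , z , hq′ , hr , y′≺z) →
    x , z , hp , hr , ≺-trans x≺y (subst (_≺ z) (deterministic hq′ hq) y′≺z) }

  ◁-respʳ : ∀ {p q r} → p ◁ q → q ∼ r → p ◁ r
  ◁-respʳ {r = r} = almost-map₂ λ { n (x , y , hp , hq , x≺y) (y′ , hq′ , hr) →
    x , y , hp , subst (r ↓ n ,_) (deterministic hq′ hq) hr , x≺y }

  ◁-respˡ : ∀ {p q r} → q ∼ p → q ◁ r → p ◁ r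
  ◁-respˡ {p} = almost-map₂ λ { n (y′ , hq′ , hp) (x , y , hq , hr , x≺y) →
    x , y , subst (p ↓ n ,_) (deterministic hq′ hq) hp , hr , x≺y }

  ◁-irrefl : ∀ {p q} → p ∼ q → ¬ p ◁ q
  ◁-irrefl eq lt with witness (almost-map₂ (λ n a b → a , b) eq lt)
  ... | n , (z , hp , hq) , (x , y , hp′ , hq′ , x≺y) =
    ≺-irrefl (subst₂ _≺_ (deterministic hp′ hp) (deterministic hq′ hq) x≺y)

  ◁-asym : ∀ {p q} → p ◁ q → ¬ q ◁ p
  ◁-asym {p} {q} lt gt = ◁-irrefl {p} {p} (∼-refl {p}) (◁-trans {p} {q} {p} lt gt)

  -- `test` does not mention the number searched for, so the search halts, at 0, just where the two
  -- values are in order. Comparison thus becomes a halting question, to which `almost-or` applies.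
  connex : ∀ p q → p ◁ q ⊎ p ∼ q ⊎ q ◁ p
  connex p q = go (almost-or (below p q)) (almost-or (below q p))
    where
    test : Fm 4
    test = ≺ᶠ (var 2F) (var 3F)
    below : 𝔻 → 𝔻 → μRec 1
    below p q = search test (φ p) (φ q)
    lt : ∀ p q → Almost (dom (below p q)) → p ◁ q
    lt p q = almost-map λ { n (x , h) → let l , m , hp , hq , l≺m = search-elim test h in l , m , hp , hq , l≺m }
    go : Almost (dom (below p q)) ⊎ Almost (λ n → ¬ dom (below p q) n) →
         Almost (dom (below q p)) ⊎ Almost (λ n → ¬ dom (below q p) n) → p ◁ q ⊎ p ∼ q ⊎ q ◁ p
    go (inj₁ a) _ = inj₁ (lt p q a)
    go (inj₂ _) (inj₁ b) = inj₂ (inj₂ (lt q p b))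
    go (inj₂ a) (inj₂ b) = inj₂ (inj₁ (almost-map₂ (λ n f g → f g)
      (almost-map₂ agree a b) (almost-map₂ (λ n hp hq → hp , hq) (total p) (total q))))
      where
      agree : ∀ n → ¬ dom (below p q) n → ¬ dom (below q p) n →
        (∃ λ x → p ↓ n , x) × (∃ λ y → q ↓ n , y) → ∃ λ x → p ↓ n , x × q ↓ n , x
      agree n ≮ ≯ ((x , hp) , (y , hq)) with ≺-connex (values p hp) (values q hq)
      ... | inj₁ x≺y         = ⊥-elim (≮ (search-intro test {x = 0} hp hq x≺y))
      ... | inj₂ (inj₁ refl) = x , hp , hq
      ... | inj₂ (inj₂ y≺x)  = ⊥-elim (≯ (search-intro test {x = 0} hq hp y≺x))

  search-𝔻 : ∀ (θ : Fm 4) p q → (∀ {x n l m} → truth θ (x ∷ n ∷ l ∷ m ∷ []) → InL x) →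
    Almost (λ n → ∀ l m → p ↓ n , l → q ↓ n , m → ∃ λ x → truth θ (x ∷ n ∷ l ∷ m ∷ [])) → 𝔻
  search-𝔻 θ p q θ⊆L found = record
    { φ       = search θ (φ p) (φ q)
    ; values  = λ h → let _ , _ , _ , _ , t = search-elim θ h in θ⊆L t
    ; defined = Almost⇒⊆* (almost-map₂ (λ { n (l , hp) (m , hq , f) → let x , t = f l m hp hq in search-intro θ hp hq t })
        (total p) (almost-map₂ (λ { n (m , hq) f → m , hq , f }) (total q) found))
    }

  e′ : ℕ → ℕ
  e′ = e em

  const : ℕ → 𝔻
  const k = record
    { φ       = prog (lit {1} (e′ k))
    ; values  = λ h → subst InL (deterministic (correct (lit (e′ k)) _) h) (e∈L em k)
    ; defined = Almost⇒⊆* (always λ n → e′ k , correct (lit (e′ k)) _)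
    }

  const-↓ : ∀ k n → const k ↓ n , e′ k
  const-↓ k n = correct (lit (e′ k)) (n ∷ [])

  const-mono : ∀ {k l} → k < l → const k ◁ const l
  const-mono {k} {l} k<l = always λ n → e′ k , e′ l , const-↓ k n , const-↓ l n , e-mono em k<l

  Nonstandard : 𝔻 → Set
  Nonstandard p = ∀ k → const k ◁ p

  -- By induction on `k`: an element that is no constant lies neither below `e′ 0` nor strictly
  -- between `e′ k` and `e′ (suc k)`, by the adjacency of these in 𝓛.
  standard-or : ∀ p → (∃ λ k → const k ∼ p) ⊎ Nonstandard p
  standard-or p with em {∃ λ k → const k ∼ p}
  ... | yes s = inj₁ s
  ... | no ¬s = inj₂ above
    where
    above : Nonstandard p
    above k with connex (const k) p
    ... | inj₁ lt        = lt
    ... | inj₂ (inj₁ eq) = ⊥-elim (¬s (k , eq))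
    above zero | inj₂ (inj₂ gt) with witness gt
    ... | n , x , y , _ , hy , x≺y =
      ⊥-elim (no-element-below-e₀ em (subst (x ≺_) (deterministic hy (const-↓ 0 n)) x≺y))
    above (suc k) | inj₂ (inj₂ gt) with witness (almost-map₂ (λ n a b → a , b) (above k) gt)
    ... | n , (x , y , hx , hp , x≺y) , (y′ , z , hp′ , hz , y≺z) =
      ⊥-elim (e-adjacent em {k} (subst₂ _≺_ (deterministic hx (const-↓ k n)) (deterministic hp hp′) x≺y)
        (subst (y′ ≺_) (deterministic hz (const-↓ (suc k) n)) y≺z))

  above-const : ∀ {p} k → Nonstandard p → Almost λ n → ∀ x → p ↓ n , x → e′ k ≺ x
  above-const k ns = almost-map (λ { n (x , y , hk , hp , x≺y) z hz →
    subst₂ _≺_ (deterministic hk (const-↓ k n)) (deterministic hp hz) x≺y }) (ns k)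

  nonstandard-intro : ∀ {p} → (∀ k → Almost λ n → ∀ x → p ↓ n , x → e′ k ≺ x) → Nonstandard p
  nonstandard-intro {p} f k = almost-map₂ (λ { n g (x , h) → e′ k , x , const-↓ k n , h , g x h }) (f k) (total p)

  ◁-intro : ∀ {p q} → (Almost λ n → ∀ x y → p ↓ n , x → q ↓ n , y → x ≺ y) → p ◁ q
  ◁-intro {p} {q} a = almost-map₂ (λ { n f ((x , hp) , (y , hq)) → x , y , hp , hq , f x y hp hq }) a
    (almost-map₂ (λ n a b → a , b) (total p) (total q))

  -- The value at `n` is the first element of 𝓛 that is numerically at least `n`. All numerically
  -- large elements lie above `e′ k`, so every constant is outgrown.
  some-nonstandard : ∃ Nonstandard
  some-nonstandard = ν , nonstandard-intro {ν} λ k →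
    let N , above = eventually-above em (e∈L em k)
    in eventually N λ n N≤n x h →
      let _ , _ , _ , _ , lx , n≤x = search-elim θ h in above x lx (≤-trans N≤n n≤x)
    where
    θ : Fm 4
    θ = inLᶠ (var 0F) ∧ᶠ var 1F ≤ᶠ var 0F
    ν : 𝔻
    ν = search-𝔻 θ (const 0) (const 0) proj₁ (always λ n _ _ _ _ →
      let x , lx , n≤x , _ = L-unbounded n in x , lx , n≤x)

  above : ∀ {p} → Nonstandard p → ∃ λ q → Nonstandard q × p ◁ q
  above {p} ns = q , (λ k → ◁-trans {const k} {p} {q} (ns k) p◁q) , p◁q
    where
    θ : Fm 4
    θ = ≺ᶠ (var 2F) (var 0F)
    q : 𝔻
    q = search-𝔻 θ p p (proj₂ ∘ ≺-dom) (always λ n l _ hp _ →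
      let x , l≺x , _ = successor em (values p hp) in x , l≺x)
    p◁q : p ◁ q
    p◁q = ◁-intro {p} {q} (always λ n x y hx hy →
      let _ , _ , hl , _ , l≺y = search-elim θ hy in subst (_≺ y) (deterministic hl hx) l≺y)

  -- Up to finitely many n, the value at n is the largest x below p n among
  -- the numbers less than n, or something larger.
  below : ∀ {p} → Nonstandard p → ∃ λ q → Nonstandard q × q ◁ p
  below {p} ns = q , nonstandard-intro {q} large , q◁p
    where
    θ : Fm 4
    θ = ≺ᶠ (var 0F) (var 2F) ∧ᶠ all< (var 1F) (≺ᶠ (var 0F) (var 3F) →ᶠ (≺ᶠ (var 0F) (var 1F) ∨ᶠ var 0F ≡ᶠ var 1F))
    predecessor : ∀ n l → InL l → e′ 0 ≺ l → ∃ λ x → truth θ (x ∷ n ∷ l ∷ l ∷ [])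
    predecessor n l ll e₀≺l with e-onto em ll
    ... | zero  , refl = ⊥-elim (≺-irrefl e₀≺l)
    ... | suc k , refl = e′ k , e-mono em {k} ≤-refl , λ i _ i≺l → maximal i i≺l
      where
      maximal : ∀ i → i ≺ e′ (suc k) → i ≺ e′ k ⊎ i ≡ e′ k
      maximal i i≺l with ≺-connex (proj₁ (≺-dom i≺l)) (e∈L em k)
      ... | inj₁ lt        = inj₁ lt
      ... | inj₂ (inj₁ eq) = inj₂ eq
      ... | inj₂ (inj₂ gt) = ⊥-elim (e-adjacent em {k} gt i≺l)
    q : 𝔻
    q = search-𝔻 θ p p (proj₁ ∘ ≺-dom ∘ proj₁) (almost-map
      (λ n f l m hl _ → predecessor n l (values p hl) (f l hl)) (above-const {p} 0 ns))
    q◁p : q ◁ p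
    q◁p = ◁-intro {q} {p} (always λ n x y hx hy →
      let _ , _ , hl , _ , x≺l , _ = search-elim θ hx in subst (x ≺_) (deterministic hl hy) x≺l)
    large : ∀ k → Almost λ n → ∀ x → q ↓ n , x → e′ k ≺ x
    large k = almost-map₂ (λ n f g x hx →
        let l , _ , hl , _ , _ , max = search-elim θ hx in closer x (max (e′ (suc k)) g (f l hl)))
      -- Beyond this bound `e′ (suc k)` is among the numbers less than `n`, and it almost always
      -- lies below `p n`. So the value found is at least `e′ (suc k)`, which exceeds `e′ k`.
      (above-const {p} (suc k) ns) (eventually (suc (e′ (suc k))) λ n le → le)
      where
      closer : ∀ x → e′ (suc k) ≺ x ⊎ e′ (suc k) ≡ x → e′ k ≺ x
      closer x (inj₁ lt)   = ≺-trans (e-mono em {k} ≤-refl) lt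
      closer x (inj₂ refl) = e-mono em {k} ≤-refl

  Between : 𝔻 → 𝔻 → ℕ → Set
  Between p q n = ∃ λ x → ∃ λ l → ∃ λ m → p ↓ n , l × q ↓ n , m × l ≺ x × x ≺ m

  -- If the search for an element between the two values halts almost always, the search is itself
  -- the required `r`.
  between-or : ∀ {p q} → p ◁ q → (∃ λ r → p ◁ r × r ◁ q) ⊎ (Almost λ n → ¬ Between p q n)
  between-or {p} {q} p◁q = go (almost-or (search θ (φ p) (φ q)))
    where
    θ : Fm 4
    θ = ≺ᶠ (var 2F) (var 0F) ∧ᶠ ≺ᶠ (var 0F) (var 3F)
    go : Almost (dom (search θ (φ p) (φ q))) ⊎ Almost (λ n → ¬ dom (search θ (φ p) (φ q)) n) →
         (∃ λ r → p ◁ r × r ◁ q) ⊎ (Almost λ n → ¬ Between p q n)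
    go (inj₂ a) = inj₂ (almost-map (λ { n ¬d (x , l , m , hp , hq , l≺x , x≺m) →
      ¬d (search-intro θ hp hq (l≺x , x≺m)) }) a)
    go (inj₁ a) = inj₁ (r ,
      ◁-intro {p} {r} (always λ n x y hx hy →
        let _ , _ , hl , _ , l≺y , _ = search-elim θ hy in subst (_≺ y) (deterministic hl hx) l≺y) ,
      ◁-intro {r} {q} (always λ n x y hx hy →
        let _ , _ , _ , hm , _ , x≺m = search-elim θ hx in subst (x ≺_) (deterministic hm hy) x≺m))
      where
      r : 𝔻
      r = record
        { φ       = search θ (φ p) (φ q)
        ; values  = λ h → let _ , _ , _ , _ , l≺x , _ = search-elim θ h in proj₂ (≺-dom l≺x)
        ; defined = Almost⇒⊆* a
        }

-- Density of the nonstandard part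

formula : ∀ {k} {R : Pred (Vec ℕ k) 0ℓ} → Computable R → Fm k
formula {k} {R} (f , c) = mkFm R (mkFun val f ok) dec
  where
  val : Vec ℕ k → ℕ
  val xs with c xs
  ... | inj₁ _ = 1
  ... | inj₂ _ = 0
  ok : ∀ xs → f [ xs ]⇓ val xs
  ok xs with c xs
  ... | inj₁ (_ , h) = h
  ... | inj₂ (_ , h) = h
  dec : ∀ xs → Tests (R xs) (val xs)
  dec xs with c xs
  ... | inj₁ (r , _) = inj₁ (r , refl)
  ... | inj₂ (r , _) = inj₂ (r , refl)

-- `μ` looks for a zero of the characteristic function, that is, for the first counterexample to
-- `R`.
μ-refutes : ∀ {k} {R : Pred (Vec ℕ (suc k)) 0ℓ} (c : Computable R) {xs z} →
  Least (λ z → ¬ R (z ∷ xs)) z → μ (proj₁ c) [ xs ]⇓ z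
μ-refutes {R = R} (f , c) {xs} {z} (¬r , first) = μ (λ m m<z → 0 , one m (first m m<z)) null
  where
  one : ∀ m → ¬ ¬ R (m ∷ xs) → f [ m ∷ xs ]⇓ 1
  one m ¬¬r with c (m ∷ xs)
  ... | inj₁ (_ , h) = h
  ... | inj₂ (¬r , _) = ⊥-elim (¬¬r ¬r)
  null : f [ z ∷ xs ]⇓ 0
  null with c (z ∷ xs)
  ... | inj₁ (r , _) = ⊥-elim (¬r r)
  ... | inj₂ (_ , h) = h

Greatest : (ℕ → Set) → ℕ → ℕ → Set
Greatest P n x = x < n × P x × ∀ i → i < n → x < i → ¬ P i

greatest : ∀ {P : ℕ → Set} → (∀ n → Dec (P n)) → ∀ n → (∀ i → i < n → ¬ P i) ⊎ ∃ (Greatest P n)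
greatest P? zero = inj₁ λ _ ()
greatest P? (suc n) with P? n | greatest P? n
... | yes p | _         = inj₂ (n , ≤-refl , p , λ i i≤n n<i → ⊥-elim (<-irrefl refl (<-≤-trans n<i (≤-pred i≤n))))
... | no ¬p | inj₁ none = inj₁ (below-suc none ¬p)
... | no ¬p | inj₂ (x , x<n , px , last) = inj₂ (x , m<n⇒m<1+n x<n , px , below-suc last λ _ → ¬p)

double≢suc-double : ∀ x y → ¬ x + x ≡ suc (y + y)
double≢suc-double (suc x) zero    eq = 1+n≢0 (trans (sym (+-suc x x)) (suc-injective eq))
double≢suc-double (suc x) (suc y) eq = double≢suc-double x y
  (suc-injective (suc-injective (trans (sym (cong suc (+-suc x x))) (trans eq (cong (λ n → suc (suc n)) (+-suc y y))))))

even-or-odd : ∀ d → (∃ λ x → d ≡ x + x) ⊎ (∃ λ x → suc d ≡ x + x)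
even-or-odd zero = inj₁ (0 , refl)
even-or-odd (suc d) with even-or-odd d
... | inj₁ (x , eq) = inj₂ (suc x , cong suc (trans (cong suc eq) (sym (+-suc x x))))
... | inj₂ (x , eq) = inj₁ (x , eq)

module Iteration (f : μRec 1) where

  iterate : μRec 2
  iterate = prec (proj 0F) (comp f (proj 1F ∷ []))

  -- The number of applications of `f` after which 0 is first reached; for `next` it is the length
  -- of the chain.
  depth : μRec 1
  depth = μ iterate

  -- `prec` adds an application of `f` at the end of the chain; the induction on `d` moves it to the
  -- beginning.
  iterate-shift : ∀ {n n′ r} d → f ⟨ n ⟩↓= n′ → iterate [ d ∷ n′ ∷ [] ]⇓ r → iterate [ suc d ∷ n ∷ [] ]⇓ r
  iterate-shift zero    h (prec₀ (proj _)) = precₛ (prec₀ (proj 0F)) (comp (proj 1F ∷ []) h)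
  iterate-shift (suc d) h (precₛ {r = r} H (comp (proj _ ∷ []) hf)) =
    precₛ (iterate-shift d h H) (comp (proj 1F ∷ []) hf)

  depth-zero : ∀ {n} → f ⟨ suc n ⟩↓= 0 → depth ⟨ suc n ⟩↓= 1
  depth-zero {n} h = μ (λ { zero _ → n , prec₀ (proj 0F) ; (suc m) (s≤s ()) }) (iterate-shift 0 h (prec₀ (proj 0F)))

  depth-suc : ∀ {n n′ d} → f ⟨ suc n ⟩↓= n′ → depth ⟨ n′ ⟩↓= d → depth ⟨ suc n ⟩↓= suc d
  depth-suc {n} {d = d} h (μ below at) = μ
    (λ { zero _ → n , prec₀ (proj 0F)
       ; (suc m) (s≤s m<d) → let y , hy = below m m<d in y , iterate-shift m h hy })
    (iterate-shift d h at)

module Density (em : ExcludedMiddle 0ℓ) (C : Pred ℕ 0ℓ) (coh : Cohesive C)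
  {R : Pred (Vec ℕ 3) 0ℓ} (R-computable : Computable R)
  (C⇔ : ∀ n → C n ⇔ (∃ λ y → ∀ z → R (z ∷ y ∷ n ∷ []))) where

  open Power em C coh
  open D

  -- It halts at `y` and `n` exactly if `y` is no witness for `n` being in `C`; its key is what the
  -- stages of 𝓛 watch.
  refuter : μRec 2
  refuter = μ (proj₁ R-computable)

  key : ℕ → ℕ → ℕ
  key y n = pair ⌜ refuter ⌝ ⟨ y ∷ n ∷ [] ⟩

  keyᶠ : ∀ {k} → Fun k → Fun k → Fun k
  keyᶠ f g = pairᶠ (lit ⌜ refuter ⌝) (pairᶠ f (pairᶠ g (lit 0)))

  -- The stage bound that the adjacent pair a ≺ b provides replaces ∀ z.
  Verified : ℕ → ℕ → ℕ → Set
  Verified n a b = ∃ λ y → y < suc a × key y n ≼ fst a ×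
    (∀ z → z < mediant (fst a) (fst b) → R (z ∷ y ∷ n ∷ []))

  verifiedᶠ : ∀ {k} → Fun k → Fun k → Fun k → Fm k
  verifiedᶠ f g h = substᶠ (ex< (sucᶠ (var 1F)) (≼ᶠ (keyᶠ (var 0F) (var 1F)) (fstᶠ (var 2F)) ∧ᶠ
    all< (mediantᶠ (fstᶠ (var 2F)) (fstᶠ (var 3F))) (substᶠ (formula R-computable) (var 0F ∷ var 1F ∷ var 2F ∷ []))))
    (f ∷ g ∷ h ∷ [])

  verified? : ∀ n a b → Dec (Verified n a b)
  verified? n a b = truth? (verifiedᶠ (var 0F) (var 1F) (var 2F)) (n ∷ a ∷ b ∷ [])

  -- A counterexample would make `refuter` halt with the least one, `z₀`, at a stage that is at
  -- least `z₀`. By adjacency this stage precedes the mediant, so `z₀` is in the range already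
  -- checked.
  verified-sound : ∀ {n a b} → a ≺ b → (∀ c → ¬ (a ≺ c × c ≺ b)) → Verified n a b → C n
  verified-sound {n} {a} {b} a≺b none (y , _ , k≼a , holds) = Equivalence.from (C⇔ n) (y , true)
    where
    true : ∀ z → R (z ∷ y ∷ n ∷ [])
    true z = stable (formula R-computable) _ λ ¬r →
      let z₀ , _ , leastz = least (λ z → truth? (¬ᶠ formula R-computable) (z ∷ y ∷ n ∷ [])) {z} ¬r
          s , ev , z₀≤s = halting-event (μ-refutes R-computable leastz)
      in proj₁ leastz (holds z₀ (≤-<-trans z₀≤s (adjacent⇒settled a≺b none {key y n} k≼a ev)))

  -- A true witness `y` passes every bounded check. What remains is that the key of `y` is at most
  -- the value of `p i`, which holds almost always since `p` outgrows some constant beyond the key.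
  verified-complete : ∀ {p n} → Nonstandard p → C n →
    Almost λ i → ∀ a b → p ↓ i , a → Verified n a b
  verified-complete {p} {n} ns c =
    let y , holds = Equivalence.to (C⇔ n) c
        x , lx , _ , k≼x = L-unbounded (key y n)
        j , ej≡x = e-onto em lx
    in almost-map (λ i f a b ha →
         let k≼a = ≼-≺ {key y n} k≼x (subst (_≺ a) ej≡x (f a ha))
         in y , s≤s (y≤a y a k≼a) , k≼a , λ z _ → holds z)
       (above-const {p} j ns)
    where
    y≤a : ∀ y a → key y n ≼ fst a → y ≤ a
    y≤a y a k≼a = ≤-trans (x≤pair y (pair n 0)) (≤-trans (y≤pair ⌜ refuter ⌝ (pair y (pair n 0)))
      (≤-trans (≼⇒≤ {key y n} {fst a} k≼a) (≤-trans (fst≤ (fst a)) (fst≤ a))))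

  module Adjacent {p q : 𝔻} (ns : Nonstandard p) (p◁q : p ◁ q) (adjacent : Almost λ n → ¬ Between p q n) where

    Good : ℕ → Set
    Good n = ∃ λ a → ∃ λ b → p ↓ n , a × q ↓ n , b × (∀ i → Verified i a b → C i)

    opaque

      good : Almost Good
      good = almost-map₂ (λ { n (a , b , ha , hb , a≺b) ¬between → a , b , ha , hb ,
        λ i → verified-sound a≺b λ c (a≺c , c≺b) → ¬between (c , a , b , ha , hb , a≺c , c≺b) }) p◁q adjacent

    -- Positive, so that 0 can mark the end of a chain.
    N : ℕ
    N = suc (proj₁ good)

    good-from : ∀ {n} → N ≤ n → C n → Good n
    good-from N≤n = proj₂ good _ (≤-trans (n≤1+n _) N≤n)

    -- From `N` on, membership in `C` yields `Good`, so the lower bound lets the chain continue from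
    -- each verified candidate.
    Candidate : ℕ → ℕ → ℕ → Set
    Candidate a b i = N ≤ i × Verified i a b

    candidateᶠ : ∀ {k} → Fun k → Fun k → Fun k → Fm k
    candidateᶠ f g h = lit N ≤ᶠ h ∧ᶠ verifiedᶠ h f g

    Next : ℕ → ℕ → ℕ → ℕ → Set
    Next x n a b = (x ≡ 0 × ∀ i → i < n → ¬ Candidate a b i) ⊎ Greatest (Candidate a b) n x

    nextᶠ : Fm 4
    nextᶠ = (var 0F ≡ᶠ lit 0 ∧ᶠ all< (var 1F) (¬ᶠ candidateᶠ (var 3F) (var 4F) (var 0F))) ∨ᶠ
      (var 0F <ᶠ var 1F ∧ᶠ candidateᶠ (var 2F) (var 3F) (var 0F) ∧ᶠ
       all< (var 1F) (var 1F <ᶠ var 0F →ᶠ ¬ᶠ candidateᶠ (var 3F) (var 4F) (var 0F)))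

    opaque

      next : μRec 1
      next = search nextᶠ (φ p) (φ q)

      next-intro : ∀ {n} → Good n → n ∈ dom next
      next-intro {n} (a , b , ha , hb , _) = go (greatest (λ i → (N ≤? i) ×-dec verified? i a b) n)
        where
        go : (∀ i → i < n → ¬ Candidate a b i) ⊎ ∃ (Greatest (Candidate a b) n) → n ∈ dom next
        go (inj₁ none)    = search-intro nextᶠ {x = 0} ha hb (inj₁ (refl , none))
        go (inj₂ (x , g)) = search-intro nextᶠ {x = x} ha hb (inj₂ g)

      next-elim : ∀ {n x a b} → p ↓ n , a → q ↓ n , b → next ⟨ n ⟩↓= x → Next x n a b
      next-elim {n} {x} ha hb h =
        let l , m , hl , hm , t = search-elim nextᶠ h
        in subst₂ (Next x n) (deterministic hl ha) (deterministic hm hb) t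

    open Iteration next

    -- At a good `n`, `next` gives 0 or a smaller candidate, and soundness of verification places
    -- the candidate in `C` again.
    depth-defined : ∀ n → N ≤ n → C n → n ∈ dom depth
    depth-defined = <-rec _ go
      where
      go : ∀ n → (∀ {i} → i < n → N ≤ i → C i → i ∈ dom depth) → N ≤ n → C n → n ∈ dom depth
      go (suc n) ih N≤n c with good-from N≤n c
      ... | g@(a , b , ha , hb , sound) with next-intro g
      ...   | x , h with next-elim ha hb h
      ...     | inj₁ (refl , _) = 1 , depth-zero h
      ...     | inj₂ (x<n , (N≤x , ver) , _) =
        let d , hd = ih x<n N≤x (sound x ver) in suc d , depth-suc h hd

    -- Take `n₀` in `C` beyond `M` and `N`, then `n` in `C` so large that `n₀` is verified at `n`.
    -- The greatest candidate below `n` is at least `n₀`, hence beyond `M` too.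
    consecutive : ∀ M → ∃ λ n → ∃ λ n′ → ∃ λ d →
      (M ≤ n × C n) × (M ≤ n′ × C n′) × depth ⟨ n ⟩↓= suc d × depth ⟨ n′ ⟩↓= d
    consecutive M =
      let n₀ , M⊔N≤n₀ , c₀ = unbounded (M ⊔ N)
          K , complete = verified-complete {p} ns c₀
          n , le , c = unbounded (K ⊔ suc n₀)
          M≤n₀ = ≤-trans (m≤m⊔n M N) M⊔N≤n₀
          N≤n₀ = ≤-trans (m≤n⊔m M N) M⊔N≤n₀
          n₀<n = ≤-trans (m≤n⊔m K (suc n₀)) le
          a , b , ha , hb , sound = good-from (≤-trans N≤n₀ (<⇒≤ n₀<n)) c
          x , h = next-intro (a , b , ha , hb , sound)
      in finish M≤n₀ N≤n₀ n₀<n c sound (complete n (≤-trans (m≤m⊔n K (suc n₀)) le) c a b ha) h (next-elim ha hb h)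
      where
      finish : ∀ {n₀ n x a b} → M ≤ n₀ → N ≤ n₀ → n₀ < n → C n → (∀ i → Verified i a b → C i) →
        Verified n₀ a b → next ⟨ n ⟩↓= x → Next x n a b →
        ∃ λ n → ∃ λ n′ → ∃ λ d → (M ≤ n × C n) × (M ≤ n′ × C n′) × depth ⟨ n ⟩↓= suc d × depth ⟨ n′ ⟩↓= d
      finish {n₀} M≤ N≤ n₀<n c sound ver₀ h (inj₁ (_ , none)) = ⊥-elim (none n₀ n₀<n (N≤ , ver₀))
      finish {n₀} {suc n} {x} M≤ N≤ n₀<n c sound ver₀ h (inj₂ (_ , (N≤x , ver) , last)) =
        let d , hd = depth-defined x N≤x (sound x ver)
        in suc n , x , d , (≤-trans M≤ (<⇒≤ n₀<n) , c) ,
           (≤-trans M≤ (≮⇒≥ λ x<n₀ → last n₀ n₀<n x<n₀ (N≤ , ver₀)) , sound x ver) , depth-suc h hd , hd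

    -- Searching for half of the depth halts just at the numbers of even depth, which form the c.e.
    -- set that splits `C`.
    doubleᶠ : Fm 4
    doubleᶠ = var 2F ≡ᶠ var 0F +ᶠ var 0F

    impossible : ⊥
    impossible = go (almost-or (search doubleᶠ depth depth))
      where
      go : Almost (dom (search doubleᶠ depth depth)) ⊎ Almost (λ n → ¬ dom (search doubleᶠ depth depth) n) → ⊥
      go (inj₁ (M , even)) =
        let n , n′ , d , (M≤n , c) , (M≤n′ , c′) , hn , hn′ = consecutive M
            _ , _ , hl , _ , eq = search-elim doubleᶠ (proj₂ (even n M≤n c))
            _ , _ , hl′ , _ , eq′ = search-elim doubleᶠ (proj₂ (even n′ M≤n′ c′))
        in double≢suc-double (proj₁ (even n M≤n c)) (proj₁ (even n′ M≤n′ c′))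
             (trans (sym eq) (trans (deterministic hl hn) (cong suc (trans (deterministic hn′ hl′) eq′))))
      go (inj₂ (M , odd)) =
        let n , n′ , d , (M≤n , c) , (M≤n′ , c′) , hn , hn′ = consecutive M
            conclude : (∃ λ x → d ≡ x + x) ⊎ (∃ λ x → suc d ≡ x + x) → ⊥
            conclude = λ { (inj₁ (x , eq)) → odd n′ M≤n′ c′ (search-intro doubleᶠ {x = x} hn′ hn′ eq)
                         ; (inj₂ (x , eq)) → odd n M≤n c (search-intro doubleᶠ {x = x} hn hn eq) }
        in conclude (even-or-odd d)

  between : ∀ {p q} → Nonstandard p → p ◁ q → ∃ λ r → p ◁ r × r ◁ q
  between {p} {q} ns p◁q with between-or {p} {q} p◁q
  ... | inj₁ r        = r
  ... | inj₂ adjacent = ⊥-elim (Adjacent.impossible {p} {q} ns p◁q adjacent)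

-- Cantor's theorem

record CountableDense (A : StrictTotalOrder 0ℓ 0ℓ 0ℓ) : Set where
  private module A = StrictTotalOrder A
  field
    point   : A.Carrier
    lower   : ∀ x → ∃ λ y → y A.< x
    upper   : ∀ x → ∃ λ y → x A.< y
    between : ∀ {x y} → x A.< y → ∃ λ z → x A.< z × z A.< y
    enum    : ℕ → A.Carrier
    covers  : ∀ x → ∃ λ n → enum n A.≈ x

module Chains (A B : StrictTotalOrder 0ℓ 0ℓ 0ℓ) where

  module A = StrictTotalOrder A
  module B = StrictTotalOrder B

  Pair : Set
  Pair = A.Carrier × B.Carrier

  infix 4 _<ₚ_ _◃_

  _<ₚ_ : Pair → Pair → Set
  (a , b) <ₚ (a′ , b′) = a A.< a′ × b B.< b′

  _◃_ : Maybe Pair → Pair → Set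
  nothing ◃ q = ⊤
  just p  ◃ q = p <ₚ q

  -- A finite partial isomorphism, as a list of pairs increasing in both coordinates. The index is
  -- the left neighbour of the first pair, or `nothing` if there is none.
  data Chain (l : Maybe Pair) : Set where
    []   : Chain l
    cons : ∀ p → l ◃ p → Chain (just p) → Chain l

  data _∈ᶜ_ (q : Pair) {l} : Chain l → Set where
    here  : ∀ {h c} → q ∈ᶜ cons q h c
    there : ∀ {p h c} → q ∈ᶜ c → q ∈ᶜ cons p h c

  <ₚ-trans : ∀ {p q r} → p <ₚ q → q <ₚ r → p <ₚ r
  <ₚ-trans (x , y) (x′ , y′) = A.trans x x′ , B.trans y y′

  above-bound : ∀ {p q} {c : Chain (just p)} → q ∈ᶜ c → p <ₚ q
  above-bound (here {h = h})     = h
  above-bound (there {h = h} i) = <ₚ-trans h (above-bound i)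

  comparable : ∀ {l} {c : Chain l} {p q} → p ∈ᶜ c → q ∈ᶜ c → p <ₚ q ⊎ p ≡ q ⊎ q <ₚ p
  comparable here      here      = inj₂ (inj₁ refl)
  comparable here      (there j) = inj₁ (above-bound j)
  comparable (there i) here      = inj₂ (inj₂ (above-bound i))
  comparable (there i) (there j) = comparable i j

module Insertion (A B : StrictTotalOrder 0ℓ 0ℓ 0ℓ) (dense : CountableDense B) where

  open Chains A B
  open CountableDense dense

  record Extension {l} (c : Chain l) (a : A.Carrier) : Set where
    constructor extension
    field
      chain   : Chain l
      extends : ∀ {p} → p ∈ᶜ c → p ∈ᶜ chain
      {a′}    : A.Carrier
      {b}     : B.Carrier
      a′≈a    : a′ A.≈ a
      member  : (a′ , b) ∈ᶜ chain

  Below : Maybe Pair → A.Carrier → Set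
  Below nothing        a = ⊤
  Below (just (a′ , _)) a = a′ A.< a

  -- The walk stops at the gap into which `a` falls; the matching gap of `B` contains a point by
  -- density, or by the absence of endpoints if the gap is outermost.
  insert : ∀ {l} (c : Chain l) a → Below l a → Extension c a
  insert {nothing} [] a _ = extension (cons (a , point) tt []) (λ ()) A.Eq.refl here
  insert {just (_ , b₀)} [] a a₀<a =
    let b , b₀<b = upper b₀
    in extension (cons (a , b) (a₀<a , b₀<b) []) (λ ()) A.Eq.refl here
  insert {l} (cons (a₁ , b₁) h c) a a₀<a with A.compare a a₁
  ... | tri≈ _ a≈a₁ _ = extension (cons (a₁ , b₁) h c) (λ i → i) (A.Eq.sym a≈a₁) here
  ... | tri> _ _ a₁<a =
    let extension c′ ext a′≈a m = insert c a a₁<a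
    in extension (cons (a₁ , b₁) h c′) (λ { here → here ; (there i) → there (ext i) }) a′≈a (there m)
  insert {nothing} (cons (a₁ , b₁) h c) a a₀<a | tri< a<a₁ _ _ =
    let b , b<b₁ = lower b₁
    in extension (cons (a , b) tt (cons (a₁ , b₁) (a<a₁ , b<b₁) c))
         (λ { here → there here ; (there i) → there (there i) }) A.Eq.refl here
  insert {just (_ , b₀)} (cons (a₁ , b₁) (_ , b₀<b₁) c) a a₀<a | tri< a<a₁ _ _ =
    let b , b₀<b , b<b₁ = between b₀<b₁
    in extension (cons (a , b) (a₀<a , b₀<b) (cons (a₁ , b₁) (a<a₁ , b<b₁) c))
         (λ { here → there here ; (there i) → there (there i) }) A.Eq.refl here

module Flip (A B : StrictTotalOrder 0ℓ 0ℓ 0ℓ) where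

  open Chains A B
  module F = Chains B A

  swap? : Maybe Pair → Maybe F.Pair
  swap? nothing  = nothing
  swap? (just p) = just (swap p)

  swap-◃ : ∀ l {p} → l ◃ p → swap? l F.◃ swap p
  swap-◃ nothing  _       = tt
  swap-◃ (just _) (x , y) = y , x

  -- Exchanging the coordinates lets the same insertion serve both directions of the back-and-forth
  -- construction.
  flip : ∀ {l} → Chain l → F.Chain (swap? l)
  flip     []           = F.[]
  flip {l} (cons p h c) = F.cons (swap p) (swap-◃ l h) (flip c)

  ∈-flip : ∀ {l} {c : Chain l} {p} → p ∈ᶜ c → swap p F.∈ᶜ flip c
  ∈-flip here      = F.here
  ∈-flip (there i) = F.there (∈-flip i)

module Cantor (A B : StrictTotalOrder 0ℓ 0ℓ 0ℓ) (dA : CountableDense A) (dB : CountableDense B) where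

  open Chains A B
  module dA = CountableDense dA
  module dB = CountableDense dB
  module IA = Insertion A B dB
  module IB = Insertion B A dA
  module F  = Flip A B
  module F′ = Flip B A

  half : ∀ (c : Chain nothing) n → IA.Extension c (dA.enum n)
  half c n = IA.insert c (dA.enum n) tt

  other-half : ∀ (c : Chain nothing) n → IB.Extension (F.flip c) (dB.enum n)
  other-half c n = IB.insert (F.flip c) (dB.enum n) tt

  stage : ℕ → Chain nothing
  stage zero    = []
  stage (suc n) = F′.flip (IB.Extension.chain (other-half (IA.Extension.chain (half (stage n) n)) n))

  half⇒stage : ∀ n {p} → p ∈ᶜ IA.Extension.chain (half (stage n) n) → p ∈ᶜ stage (suc n)
  half⇒stage n i = F′.∈-flip (IB.Extension.extends (other-half (IA.Extension.chain (half (stage n) n)) n) (F.∈-flip i))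

  stage-suc : ∀ n {p} → p ∈ᶜ stage n → p ∈ᶜ stage (suc n)
  stage-suc n i = half⇒stage n (IA.Extension.extends (half (stage n) n) i)

  stage-mono : ∀ {m n p} → m ≤ n → p ∈ᶜ stage m → p ∈ᶜ stage n
  stage-mono {m} {p = p} m≤n i = go (≤⇒≤′ m≤n)
    where
    go : ∀ {n} → m ≤′ n → p ∈ᶜ stage n
    go ≤′-refl      = i
    go (≤′-step {n} le) = stage-suc n (go le)

  infix 4 _↔_

  -- The union of all stages, closed under both equivalences because chains hold only
  -- representatives.
  _↔_ : A.Carrier → B.Carrier → Set
  a ↔ b = ∃ λ n → ∃ λ a′ → ∃ λ b′ → (a′ , b′) ∈ᶜ stage n × a′ A.≈ a × b′ B.≈ b

  -- Both pairs occur in a common later stage, and in a chain two pairs compare alike in both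
  -- coordinates. Preservation and reflection of order and equality all follow from this.
  compatible : ∀ {a b a′ b′} → a ↔ b → a′ ↔ b′ →
    (a A.< a′ × b B.< b′) ⊎ (a A.≈ a′ × b B.≈ b′) ⊎ (a′ A.< a × b′ B.< b)
  compatible (n , _ , _ , i , ea , eb) (n′ , _ , _ , i′ , ea′ , eb′)
    with comparable (stage-mono (m≤m⊔n n n′) i) (stage-mono (m≤n⊔m n n′) i′)
  ... | inj₁ (x , y)        = inj₁ (respA ea ea′ x , respB eb eb′ y)
    where
    respA : ∀ {x y x′ y′} → x A.≈ x′ → y A.≈ y′ → x A.< y → x′ A.< y′
    respA e e′ p = A.<-respˡ-≈ e (A.<-respʳ-≈ e′ p)
    respB : ∀ {x y x′ y′} → x B.≈ x′ → y B.≈ y′ → x B.< y → x′ B.< y′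
    respB e e′ p = B.<-respˡ-≈ e (B.<-respʳ-≈ e′ p)
  ... | inj₂ (inj₁ refl)    = inj₂ (inj₁ (A.Eq.trans (A.Eq.sym ea) ea′ , B.Eq.trans (B.Eq.sym eb) eb′))
  ... | inj₂ (inj₂ (x , y)) = inj₂ (inj₂
    (A.<-respˡ-≈ ea′ (A.<-respʳ-≈ ea x) , B.<-respˡ-≈ eb′ (B.<-respʳ-≈ eb y)))

  image : ∀ a → ∃ λ b → a ↔ b
  image a =
    let n , e = dA.covers a
        open IA.Extension (half (stage n) n)
    in b , suc n , a′ , b , half⇒stage n member , A.Eq.trans a′≈a e , B.Eq.refl

  preimage : ∀ b → ∃ λ a → a ↔ b
  preimage b₀ =
    let n , e = dB.covers b₀
        open IB.Extension (other-half (IA.Extension.chain (half (stage n) n)) n)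
    in b , suc n , b , a′ , F′.∈-flip member , A.Eq.refl , B.Eq.trans a′≈a e

  isomorphism : ⌊ A ⌋ ≅ ⌊ B ⌋
  isomorphism = (λ a → proj₁ (image a)) , record
    { isOrderMonomorphism = record
      { isOrderHomomorphism = record
        { cong = λ {x} {y} e → preserves-≈ e (proj₂ (image x)) (proj₂ (image y))
        ; mono = λ {x} {y} p → preserves-< p (proj₂ (image x)) (proj₂ (image y))
        }
      ; injective = λ {x} {y} e → reflects-≈ e (proj₂ (image x)) (proj₂ (image y))
      ; cancel    = λ {x} {y} p → reflects-< p (proj₂ (image x)) (proj₂ (image y))
      }
    ; surjective = λ b → let a , r = preimage b in a , λ {z} e → preserves-≈ e (proj₂ (image z)) r
    }
    where
    preserves-≈ : ∀ {a b a′ b′} → a A.≈ a′ → a ↔ b → a′ ↔ b′ → b B.≈ b′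
    preserves-≈ e r r′ with compatible r r′
    ... | inj₁ (p , _)        = ⊥-elim (A.irrefl e p)
    ... | inj₂ (inj₁ (_ , q)) = q
    ... | inj₂ (inj₂ (p , _)) = ⊥-elim (A.irrefl (A.Eq.sym e) p)
    preserves-< : ∀ {a b a′ b′} → a A.< a′ → a ↔ b → a′ ↔ b′ → b B.< b′
    preserves-< a<a′ r r′ with compatible r r′
    ... | inj₁ (_ , q)        = q
    ... | inj₂ (inj₁ (e , _)) = ⊥-elim (A.irrefl e a<a′)
    ... | inj₂ (inj₂ (p , _)) = ⊥-elim (A.asym p a<a′)
    reflects-≈ : ∀ {a b a′ b′} → b B.≈ b′ → a ↔ b → a′ ↔ b′ → a A.≈ a′
    reflects-≈ e r r′ with compatible r r′
    ... | inj₁ (_ , q)        = ⊥-elim (B.irrefl e q)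
    ... | inj₂ (inj₁ (p , _)) = p
    ... | inj₂ (inj₂ (_ , q)) = ⊥-elim (B.irrefl (B.Eq.sym e) q)
    reflects-< : ∀ {a b a′ b′} → b B.< b′ → a ↔ b → a′ ↔ b′ → a A.< a′
    reflects-< b<b′ r r′ with compatible r r′
    ... | inj₁ (p , _)        = p
    ... | inj₂ (inj₁ (_ , e)) = ⊥-elim (B.irrefl e b<b′)
    ... | inj₂ (inj₂ (_ , q)) = ⊥-elim (B.asym q b<b′)

η-dense : CountableDense η
η-dense = record
  { point   = ℚ.0ℚ
  ; lower   = λ x → x ℚ.+ ℚ.- ℚ.1ℚ ,
      subst (x ℚ.+ ℚ.- ℚ.1ℚ ℚ.<_) (ℚ.+-identityʳ x) (ℚ.+-monoʳ-< x (ℚ.negative⁻¹ (ℚ.- ℚ.1ℚ)))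
  ; upper   = λ x → x ℚ.+ ℚ.1ℚ ,
      subst (ℚ._< x ℚ.+ ℚ.1ℚ) (ℚ.+-identityʳ x) (ℚ.+-monoʳ-< x (ℚ.positive⁻¹ ℚ.1ℚ))
  ; between = ℚ.<-dense
  -- The code holds the numerator as a difference of two naturals and the denominator minus one;
  -- unreduced fractions merely cause repetitions.
  ; enum    = λ n → (fst (fst n) ℤ.⊖ snd (fst n)) ℚ./ suc (snd n)
  ; covers  = λ x → let a , b , eq = difference (ℚ.↥ x) in pair (pair a b) (ℚ.ℚ.denominator-1 x) , code a b x eq
  }
  where
  difference : ∀ i → ∃ λ a → ∃ λ b → a ℤ.⊖ b ≡ i
  difference (ℤ.+ n)    = n , 0 , refl
  difference ℤ.-[1+ n ] = 0 , suc n , refl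
  code : ∀ a b x → a ℤ.⊖ b ≡ ℚ.↥ x → let n = pair (pair a b) (ℚ.ℚ.denominator-1 x) in
    (fst (fst n) ℤ.⊖ snd (fst n)) ℚ./ suc (snd n) ≡ x
  code a b x eq
    rewrite fst-pair (pair a b) (ℚ.ℚ.denominator-1 x) | snd-pair (pair a b) (ℚ.ℚ.denominator-1 x)
          | fst-pair a b | snd-pair a b | eq = ℚ.↥p/↧p≡p x

-- Gluing the constants and the nonstandard part

module CohesivePower (em : ExcludedMiddle 0ℓ) (C : Pred ℕ 0ℓ) (coh : Cohesive C)
  {R : Pred (Vec ℕ 3) 0ℓ} (R-computable : Computable R)
  (C⇔ : ∀ n → C n ⇔ (∃ λ y → ∀ z → R (z ∷ y ∷ n ∷ []))) where

  open Power em C coh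
  open Density em C coh R-computable C⇔ using (between)

  N : StrictTotalOrder 0ℓ 0ℓ 0ℓ
  N = record
    { Carrier = Σ 𝔻 Nonstandard
    ; _≈_     = _∼_ on proj₁
    ; _<_     = _◁_ on proj₁
    ; isStrictTotalOrder = record
      { isStrictPartialOrder = record
        { isEquivalence = record
          { refl  = λ {(p , _)} → ∼-refl {p}
          ; sym   = λ {(p , _)} {(q , _)} → ∼-sym {p} {q}
          ; trans = λ {(p , _)} {(q , _)} {(r , _)} → ∼-trans {p} {q} {r}
          }
        ; irrefl   = λ {(p , _)} {(q , _)} → ◁-irrefl {p} {q}
        ; trans    = λ {(p , _)} {(q , _)} {(r , _)} → ◁-trans {p} {q} {r}
        ; <-resp-≈ = (λ {(r , _)} {(p , _)} {(q , _)} e l → ◁-respʳ {r} {p} {q} l e)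
                   , (λ {(r , _)} {(p , _)} {(q , _)} e l → ◁-respˡ {q} {p} {r} e l)
        }
      ; compare = λ (p , _) (q , _) → cmp p q (connex p q)
      }
    }
    where
    cmp : ∀ p q → p ◁ q ⊎ p ∼ q ⊎ q ◁ p → Tri (p ◁ q) (p ∼ q) (q ◁ p)
    cmp p q (inj₁ lt)        = tri< lt (λ eq → ◁-irrefl {p} {q} eq lt) (◁-asym {p} {q} lt)
    cmp p q (inj₂ (inj₁ eq)) = tri≈ (◁-irrefl {p} {q} eq) eq (◁-irrefl {q} {p} (∼-sym {p} {q} eq))
    cmp p q (inj₂ (inj₂ gt)) = tri> (◁-asym {q} {p} gt) (λ eq → ◁-irrefl {q} {p} (∼-sym {p} {q} eq) gt) gt

  N-dense : CountableDense N
  N-dense = record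
    { point   = some-nonstandard
    ; lower   = λ (p , ns) → let q , nq , lt = below {p} ns in (q , nq) , lt
    ; upper   = λ (p , ns) → let q , nq , lt = above {p} ns in (q , nq) , lt
    ; between = λ {(p , np)} {(q , _)} lt → let r , p◁r , r◁q = between {p} {q} np lt
        in (r , λ k → ◁-trans {const k} {p} {r} (np k) p◁r) , p◁r , r◁q
    ; enum    = λ n → choose n em
    ; covers  = λ (p , np) → ⌜ D.φ p ⌝ , chosen p np em
    }
    where
    -- Two elements with the same code are =C-equal, so one per code suffices.
    Coded : ℕ → Set
    Coded n = ∃ λ (x : Σ 𝔻 Nonstandard) → ⌜ D.φ (proj₁ x) ⌝ ≡ n
    choose : ∀ n → Dec (Coded n) → Σ 𝔻 Nonstandard
    choose n (yes (x , _)) = x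
    choose n (no _)        = some-nonstandard
    chosen : ∀ p np (d : Dec (Coded ⌜ D.φ p ⌝)) → proj₁ (choose _ d) ∼ p
    chosen p np (no none)             = ⊥-elim (none ((p , np) , refl))
    chosen p np (yes ((q , _) , eq)) = almost-map₂
      (λ n (x , hq) (y , hp) → x , hq , subst (p ↓ n ,_) (sym (code-determines eq hq hp)) hp) (total q) (total p)

  open StrictTotalOrder (ω ⊕ η) using () renaming (Carrier to Target; _≈_ to _≋_; _<_ to _⊲_)

  nonstandard-part : ⌊ N ⌋ ≅ ⌊ η ⌋
  nonstandard-part = Cantor.isomorphism N η N-dense η-dense

  open IsOrderIsomorphism (proj₂ nonstandard-part)
    using (mono; injective; cancel; surjective) renaming (cong to congruent)

  ρ : Σ 𝔻 Nonstandard → ℚ.ℚ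
  ρ = proj₁ nonstandard-part

  Position : 𝔻 → Set
  Position p = (∃ λ k → const k ∼ p) ⊎ Nonstandard p

  -- With the position as an argument, the lemmas below go by cases on arbitrary positions; up to
  -- `≋` the value is independent of the position chosen.
  place : ∀ p → Position p → Target
  place _ (inj₁ (k , _)) = inj₁ k
  place p (inj₂ np)      = inj₂ (ρ (p , np))

  const-injective : ∀ {k l} → const k ∼ const l → k ≡ l
  const-injective {k} {l} e =
    let n , x , hk , hl = witness e
    in e-injective em (trans (deterministic (const-↓ k n) hk) (deterministic hl (const-↓ l n)))

  const-cancel : ∀ {k l} → const k ◁ const l → k < l
  const-cancel {k} {l} lt =
    let n , x , y , hk , hl , x≺y = witness lt
    in e-cancel em (subst₂ _≺_ (deterministic hk (const-↓ k n)) (deterministic hl (const-↓ l n)) x≺y)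

  standard≁nonstandard : ∀ {k p} → const k ∼ p → ¬ Nonstandard p
  standard≁nonstandard {k} {p} e np = ◁-irrefl {const k} {p} e (np k)

  place-cong : ∀ p q (s : Position p) (t : Position q) → p ∼ q → place p s ≋ place q t
  place-cong p q (inj₁ (k , e)) (inj₁ (l , e′)) eq = ⊎.inj₁
    (const-injective (∼-trans {const k} {p} {const l} e (∼-trans {p} {q} {const l} eq (∼-sym {const l} {q} e′))))
  place-cong p q (inj₁ (k , e)) (inj₂ nq) eq = ⊥-elim (standard≁nonstandard {k} {q} (∼-trans {const k} {p} {q} e eq) nq)
  place-cong p q (inj₂ np) (inj₁ (l , e)) eq =
    ⊥-elim (standard≁nonstandard {l} {p} (∼-trans {const l} {q} {p} e (∼-sym {p} {q} eq)) np)
  place-cong p q (inj₂ np) (inj₂ nq) eq = ⊎.inj₂ (congruent {p , np} {q , nq} eq)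

  place-mono : ∀ p q (s : Position p) (t : Position q) → p ◁ q → place p s ⊲ place q t
  place-mono p q (inj₁ (k , e)) (inj₁ (l , e′)) lt = ₁∼₁
    (const-cancel (◁-respˡ {const k} {p} {const l} (∼-sym {const k} {p} e) (◁-respʳ {p} {q} {const l} lt (∼-sym {const l} {q} e′))))
  place-mono _ _ (inj₁ _) (inj₂ _) lt = ₁∼₂
  -- Whatever lies above a nonstandard element is nonstandard, hence equal to no constant.
  place-mono p q (inj₂ np) (inj₁ (l , e)) lt =
    ⊥-elim (standard≁nonstandard {l} {q} e λ k → ◁-trans {const k} {p} {q} (np k) lt)
  place-mono p q (inj₂ np) (inj₂ nq) lt = ₂∼₂ (mono {p , np} {q , nq} lt)

  place-injective : ∀ p q (s : Position p) (t : Position q) → place p s ≋ place q t → p ∼ q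
  place-injective p q (inj₁ (k , e)) (inj₁ (.k , e′)) (⊎.inj₁ refl) = ∼-trans {p} {const k} {q} (∼-sym {const k} {p} e) e′
  place-injective p q (inj₂ np) (inj₂ nq) (⊎.inj₂ eq) = injective {p , np} {q , nq} eq

  place-cancel : ∀ p q (s : Position p) (t : Position q) → place p s ⊲ place q t → p ◁ q
  place-cancel p q (inj₁ (k , e)) (inj₁ (l , e′)) (₁∼₁ k<l) =
    ◁-respˡ {p} {const k} {q} e (◁-respʳ {const k} {const l} {q} (const-mono k<l) e′)
  place-cancel p q (inj₁ (k , e)) (inj₂ nq) ₁∼₂ = ◁-respˡ {p} {const k} {q} e (nq k)
  place-cancel p q (inj₂ np) (inj₂ nq) (₂∼₂ lt) = cancel {p , np} {q , nq} lt

  isomorphism : cohesivePower C 𝓛 ≅ ⌊ ω ⊕ η ⌋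
  isomorphism = (λ p → place p (standard-or p)) , record
    { isOrderMonomorphism = record
      { isOrderHomomorphism = record
        { cong = λ {p} {q} e → place-cong p q (standard-or p) (standard-or q) (⊆*⇒Almost e)
        ; mono = λ {p} {q} l → place-mono p q (standard-or p) (standard-or q) (⊆*⇒Almost l)
        }
      ; injective = λ {p} {q} e → Almost⇒⊆* (place-injective p q (standard-or p) (standard-or q) e)
      ; cancel    = λ {p} {q} l → Almost⇒⊆* (place-cancel p q (standard-or p) (standard-or q) l)
      }
    ; surjective = onto
    }
    where
    onto : ∀ y → ∃ λ p → ∀ {q} → C ⊆* (λ n → ∃ λ m → D.φ q ⟨ n ⟩↓= m × D.φ p ⟨ n ⟩↓= m) → place q (standard-or q) ≋ y
    onto (inj₁ k) = const k , λ {q} e → place-cong q (const k) (standard-or q) (inj₁ (k , ∼-refl {const k})) (⊆*⇒Almost e)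
    onto (inj₂ r) =
      let (p , np) , hits = surjective r
      in p , λ {q} e → subst (λ r → place q (standard-or q) ≋ inj₂ r) (hits {p , np} (∼-refl {p}))
           (place-cong q p (standard-or q) (inj₂ np) (⊆*⇒Almost e))

corollary4p2 : ExcludedMiddle 0ℓ →
    Σ ComputableLinearOrder λ 𝓛 → IsCopyOfω 𝓛 ×
      (∀ (C : Pred ℕ 0ℓ) → Δ⁰ 2 C → Cohesive C →
        cohesivePower C 𝓛 ≅ ⌊ ω ⊕ η ⌋)
corollary4p2 em = 𝓛 , 𝓛-copy em , λ
  -- The pattern reads the computable matrix `R` off the Σ₂ form of `C`, and the two equivalences
  -- compose to membership as `∃ y` and `∀ z`.
  { C (ex (all (base R-computable) S⇔) C⇔ , _) coh →
    CohesivePower.isomorphism em C coh R-computable λ n →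
      mk⇔ (λ c → let y , s = Equivalence.to (C⇔ (n ∷ [])) c in y , Equivalence.to (S⇔ (y ∷ n ∷ [])) s)
          (λ (y , s) → Equivalence.from (C⇔ (n ∷ [])) (y , Equivalence.from (S⇔ (y ∷ n ∷ [])) s)) }
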